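{- For every integer $n\ge 76$, every integer in the interval $\left[-\binom{\lfloor(2n+1)/3\rfloor}{2},\ \binom{\lfloor(2n+1)/3\rfloor}{2}\right]$ is an eigenvalue of the transposition graph $\mathrm{Cay}(S_n,T_n)$.
   Context: $S_n$ is the symmetric group on $\{1,\dots,n\}$ and $T_n\subseteq S_n$ is the set of all transpositions. The transposition graph $\mathrm{Cay}(S_n,T_n)$ is the Cayley graph with vertex set $S_n$ in which $f,g\in S_n$ are adjacent iff $fg^{ -1}\in T_n$. Its eigenvalues are the eigenvalues of its adjacency matrix. -}

module Defs where

open import Data.Nat using (ℕ; _<?_)
open import Data.Fin using (Fin; toℕ)
open import Data.Fin.Permutation using (Permutation′; _⟨$⟩ʳ_; _∘ₚ_; transpose)
open import Data.List using (List; []; _∷_; allFin; foldr; map; concatMap)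
open import Data.Integer using (ℤ)
open import Data.Rational using (ℚ; 0ℚ; _+_; _*_; _/_)
open import Data.Product using (∃; _×_; _,_)
open import Relation.Nullary using (¬_)
open import Relation.Nullary.Decidable using (does)
open import Data.Bool using (if_then_else_)
open import Relation.Binary.PropositionalEquality using (_≡_)

Sym : ℕ → Set
Sym n = Permutation′ n

_≈ₛ_ : ∀ {n} → Sym n → Sym n → Set
f ≈ₛ g = ∀ i → f ⟨$⟩ʳ i ≡ g ⟨$⟩ʳ i

record Vector (n : ℕ) : Set where
  field
    entry : Sym n → ℚ
    resp  : ∀ {f g} → f ≈ₛ g → entry f ≡ entry g
open Vector public

sumℚ : List ℚ → ℚ
sumℚ = foldr _+_ 0ℚ

-- All ordered pairs (i , j) with i < j in Fin n; these index T_n bijectively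
-- via (i , j) ↦ transpose i j.
transpositionPairs : (n : ℕ) → List (Fin n × Fin n)
transpositionPairs n =
  concatMap (λ i → concatMap (λ j → if does (toℕ i <? toℕ j) then (i , j) ∷ [] else []) (allFin n)) (allFin n)

-- Adjacency matrix of Cay(S_n, T_n) applied to a vector:
-- (A v)(f) = Σ_{g : f g⁻¹ ∈ T_n} v(g) = Σ_{t ∈ T_n} v(t f).
-- (t f is "apply f, then t", which is f ∘ₚ t in stdlib's diagrammatic order.)
adjApply : ∀ {n} → Vector n → Sym n → ℚ
adjApply {n} v f =
  sumℚ (map (λ { (i , j) → entry v (f ∘ₚ transpose i j) }) (transpositionPairs n))

-- μ is an eigenvalue of the adjacency matrix of Cay(S_n,T_n): there is a
-- nonzero vector v with A v = μ v.  (The matrix is rational, so for rational μ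
-- eigenvalues over ℚ and over ℂ coincide.)
IsTranspositionGraphEigenvalue : (n : ℕ) → ℚ → Set
IsTranspositionGraphEigenvalue n μ =
  ∃ λ (v : Vector n) → (∃ λ (f : Sym n) → ¬ (entry v f ≡ 0ℚ))
                     × (∀ (f : Sym n) → adjApply v f ≡ μ * entry v f)

ℤ→ℚ : ℤ → ℚ
ℤ→ℚ k = k / 1

{-# OPTIONS --safe #-}
module Submission where

-- Eigenvectors.  Cut the positions 1 … n into consecutive blocks of sizes h₁, h₂, … (columns
-- of a tableau) and let v f be the product over the blocks of the Vandermonde products of the
-- values of f there: a Specht polynomial evaluated at f.  Transposing two positions of one
-- block flips the sign of v; summing over the transpositions between blocks of sizes p and q
-- gives min p q times v, by Lagrange interpolation.  So v is an eigenvector, whose eigenvalue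
-- is the content sum of the Young diagram with these columns.
--
-- Content sums.  Surround a diagram with s cells and content sum c by a hook with arm a and leg
-- b: the content sum becomes c + T a - T b with T triangular, and trading a leg cell for an arm
-- cell adds n - s, where n is the new size.  If the diagrams of size s realise all contents in
-- [-M , M] and n - s ≤ 2 M + 1, the diagrams of size n thus realise a long interval.  Starting
-- from six intervals found by search, this settles 76 ≤ n < 416; for larger n take s = ⌊n / 8⌋.

open import Defs
open import Data.List using (List; []; _∷_; _++_; length; replicate; map; concatMap; allFin; tabulate)
open import Data.Nat.ListAction using () renaming (sum to total)
open import Data.Product using (∃; _×_; _,_)
open import Function using (_∘_)
open import Relation.Nullary using (Dec; yes; no; does)
open import Relation.Nullary.Negation using (contradiction)
open import Relation.Binary.PropositionalEquality
import Data.Integer.Properties as ℤ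
import Data.Nat.Properties as ℕ

module Eigenvectors where

  open import Algebra.Bundles using (module AbelianGroup)
  open import Data.Bool using (if_then_else_; true; false)
  open import Data.Fin using (Fin; zero; suc; toℕ; punchIn; punchOut; splitAt; _↑ˡ_; _↑ʳ_; _≟_)
  open import Data.Fin.Permutation using (_⟨$⟩ʳ_; _⟨$⟩ˡ_; _∘ₚ_; transpose; id; inverseˡ)
  open import Data.Fin.Properties
    using (toℕ-injective; suc-injective; punchInᵢ≢i; punchIn-punchOut; ↑ˡ-injective; ↑ʳ-injective; splitAt-↑ˡ; splitAt-↑ʳ)
  open import Data.Integer using (ℤ; -_; 0ℤ; 1ℤ; _+_; _*_; _-_) renaming (+_ to pos)
  open import Data.Integer.Tactic.RingSolver using (solve-∀)
  open import Data.List.Properties using (map-++)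
  open import Data.Nat as ℕ using (ℕ; zero; suc; _⊓_; _<?_)
  import Data.Nat.Coprimality as ℕ
  open import Data.Rational as ℚ using (ℚ; mkℚ; 0ℚ)
  import Data.Rational.Properties as ℚ
  open import Data.Sum using (inj₁; inj₂)
  open import Data.Vec.Functional using (updateAt)
  open import Data.Vec.Functional.Properties using (updateAt-updates; updateAt-minimal)
  open import Relation.Binary.Definitions using (tri<; tri≈; tri>)
  open import Relation.Nullary.Decidable using (dec-true; dec-false)
  open import Algebra.Properties.Group (AbelianGroup.group ℤ.+-0-abelianGroup) using (∙-cancelʳ)
  open import Algebra.Properties.Semiring.Sum ℤ.+-*-semiring
    using (sum; sum-syntax; sum-cong-≗; sum-remove; ∑-distrib-+; ∑-comm; ∑-permute; *-distribˡ-sum)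
  open import Algebra.Properties.CommutativeMonoid.Sum ℤ.*-1-commutativeMonoid
    using () renaming (sum to prod; sum-cong-≗ to prod-cong; sum-remove to prod-remove)
  open ≡-Reasoning

  -- Polynomial functions of bounded degree on the integers.

  Injective : ∀ {n} → (Fin n → ℤ) → Set
  Injective x = ∀ {i j} → x i ≡ x j → i ≡ j

  -- Polynomial functions of degree < d: divisibility of f − f r by t − r, with a
  -- quotient of smaller degree, replaces coefficients.
  Deg : ℕ → (ℤ → ℤ) → Set
  Deg zero    f = ∀ t → f t ≡ 0ℤ
  Deg (suc d) f = ∀ r → ∃ λ g → Deg d g × (∀ t → f t ≡ f r + (t - r) * g t)

  Deg-cong : ∀ d {f g} → f ≗ g → Deg d f → Deg d g
  Deg-cong zero    f≗g F t = trans (sym (f≗g t)) (F t)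
  Deg-cong (suc d) f≗g F r with F r
  ... | h , H , eq = h , H , λ t → trans (sym (f≗g t)) (trans (eq t) (cong (_+ _) (f≗g r)))

  Deg-+ : ∀ d {f g} → Deg d f → Deg d g → Deg d (λ t → f t + g t)
  Deg-+ zero    F G t = cong₂ _+_ (F t) (G t)
  Deg-+ (suc d) {f} {g} F G r with F r | G r
  ... | f′ , F′ , p | g′ , G′ , q = (λ t → f′ t + g′ t) , Deg-+ d F′ G′ , λ t →
    trans (cong₂ _+_ (p t) (q t)) (lemma (f r) (g r) (t - r) (f′ t) (g′ t))
    where
    lemma : ∀ a b c x y → a + c * x + (b + c * y) ≡ a + b + c * (x + y)
    lemma = solve-∀

  Deg-* : ∀ d c {f} → Deg d f → Deg d (λ t → c * f t)
  Deg-* zero    c F t = trans (cong (c *_) (F t)) (ℤ.*-zeroʳ c)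
  Deg-* (suc d) c {f} F r with F r
  ... | g , G , p = (λ t → c * g t) , Deg-* d c G , λ t → trans (cong (c *_) (p t)) (lemma c (f r) (t - r) (g t))
    where
    lemma : ∀ c a b x → c * (a + b * x) ≡ c * a + b * (c * x)
    lemma = solve-∀

  Deg-0 : ∀ d → Deg d (λ _ → 0ℤ)
  Deg-0 zero    _ = refl
  Deg-0 (suc d) r = (λ _ → 0ℤ) , Deg-0 d , λ t → sym (trans (ℤ.+-identityˡ _) (ℤ.*-zeroʳ (t - r)))

  Deg-const : ∀ d c → Deg (suc d) (λ _ → c)
  Deg-const d c r = (λ _ → 0ℤ) , Deg-0 d , λ t → sym (trans (cong (c +_) (ℤ.*-zeroʳ (t - r))) (ℤ.+-identityʳ c))

  Deg-suc : ∀ d {f} → Deg d f → Deg (suc d) f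
  Deg-suc zero    F = λ r → (λ _ → 0ℤ) , (λ _ → refl) , λ t → trans (F t) (sym (cong₂ _+_ (F r) (ℤ.*-zeroʳ (t - r))))
  Deg-suc (suc d) F r with F r
  ... | g , G , p = g , Deg-suc d G , p

  Deg-≤ : ∀ {d e f} → d ℕ.≤ e → Deg d f → Deg e f
  Deg-≤ {d} {e} d≤e F with ℕ.≤⇒≤‴ d≤e
  ... | p = go p F
    where
    go : ∀ {d f} → d ℕ.≤‴ e → Deg d f → Deg e f
    go ℕ.≤‴-refl F = F
    go (ℕ.≤‴-step q) F = go q (Deg-suc _ F)

  -- Splitting `t - c` as `(r - c) + (t - r)` and expanding only the first copy of `f t` around `r`
  -- leaves the quotient `f t + (r - c) * g t`, one degree below the product.
  Deg-linear : ∀ d c {f} → Deg d f → Deg (suc d) (λ t → (t - c) * f t)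
  Deg-linear zero c F = Deg-suc zero (λ t → trans (cong ((t - c) *_) (F t)) (ℤ.*-zeroʳ (t - c)))
  Deg-linear (suc d) c {f} F r with F r
  ... | g , G , p = (λ t → f t + (r - c) * g t) , Deg-+ (suc d) F (Deg-suc d (Deg-* d (r - c) G)) , λ t →
    trans (split t r c (f t)) (trans (cong (λ x → (r - c) * x + (t - r) * f t) (p t)) (lemma t r c (f r) (f t) (g t)))
    where
    split : ∀ t r c y → (t - c) * y ≡ (r - c) * y + (t - r) * y
    split = solve-∀
    lemma : ∀ t r c a y z → (r - c) * (a + (t - r) * z) + (t - r) * y ≡ (r - c) * a + (t - r) * (y + (r - c) * z)
    lemma = solve-∀

  Deg-∑ : ∀ d {n} (F : Fin n → ℤ → ℤ) → (∀ i → Deg d (F i)) → Deg d (λ t → ∑[ i < n ] F i t)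
  Deg-∑ d {zero}  F p = Deg-0 d
  Deg-∑ d {suc n} F p = Deg-+ d (p zero) (Deg-∑ d (F ∘ suc) (p ∘ suc))

  -- Repeated factor theorem: as ℤ has no zero divisors, the quotient by `t - y zero` vanishes at
  -- the remaining `y i`.
  roots⇒zero : ∀ d {f} → Deg d f → (y : Fin d → ℤ) → Injective y → (∀ i → f (y i) ≡ 0ℤ) → ∀ t → f t ≡ 0ℤ
  roots⇒zero zero    F y inj z t = F t
  roots⇒zero (suc d) {f} F y inj z t with F (y zero)
  ... | g , G , p = trans (factor t) (trans (cong ((t - y zero) *_) (g≡0 t)) (ℤ.*-zeroʳ (t - y zero)))
    where
    factor : ∀ t → f t ≡ (t - y zero) * g t
    factor t = trans (p t) (trans (cong (_+ (t - y zero) * g t) (z zero)) (ℤ.+-identityˡ _))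
    root : ∀ i → g (y (suc i)) ≡ 0ℤ
    root i with ℤ.i*j≡0⇒i≡0∨j≡0 (y (suc i) - y zero) (trans (sym (factor (y (suc i)))) (z (suc i)))
    ... | inj₂ eq = eq
    ... | inj₁ eq with inj (ℤ.i-j≡0⇒i≡j (y (suc i)) (y zero) eq)
    ... | ()
    g≡0 : ∀ t → g t ≡ 0ℤ
    g≡0 = roots⇒zero d G (y ∘ suc) (suc-injective ∘ inj) root

  -- Vandermonde products and their dependence on one variable.

  _[_]≔_ : ∀ {n} → (Fin n → ℤ) → Fin n → ℤ → Fin n → ℤ
  y [ i ]≔ t = updateAt y i (λ _ → t)

  R : ∀ {n} → ℤ → (Fin n → ℤ) → ℤ
  R t y = prod (λ i → t - y i)

  -- The factors are `y i - y j` for `i < j`. The recursion splits off those with the first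
  -- variable; `V-remove` does so for any variable.
  V : ∀ {n} → (Fin n → ℤ) → ℤ
  V {zero}  y = 1ℤ
  V {suc n} y = R (y zero) (y ∘ suc) * V (y ∘ suc)

  R-cong : ∀ {n} {s t} {y z : Fin n → ℤ} → s ≡ t → y ≗ z → R s y ≡ R t z
  R-cong {s = s} refl y≗z = prod-cong (λ i → cong (λ c → s - c) (y≗z i))

  V-cong : ∀ {n} {y z : Fin n → ℤ} → y ≗ z → V y ≡ V z
  V-cong {zero}  y≗z = refl
  V-cong {suc n} y≗z = cong₂ _*_ (R-cong (y≗z zero) (y≗z ∘ suc)) (V-cong (y≗z ∘ suc))

  sgn : ∀ {n} → Fin n → ℤ
  sgn zero    = 1ℤ
  sgn (suc j) = - sgn j

  R-remove : ∀ {n} t (y : Fin (suc n) → ℤ) j → R t y ≡ (t - y j) * R t (y ∘ punchIn j)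
  R-remove t y j = prod-remove {i = j} (λ i → t - y i)

  -- Bringing the factors with `y j` to the front reverses one difference for each position before
  -- `j`, whence the sign.
  V-remove : ∀ {n} (y : Fin (suc n) → ℤ) j →
             V y ≡ sgn j * (R (y j) (y ∘ punchIn j) * V (y ∘ punchIn j))
  V-remove y zero = sym (ℤ.*-identityˡ _)
  V-remove {suc n} y (suc j) = begin
    R (y zero) (y ∘ suc) * V (y ∘ suc)
      ≡⟨ cong₂ _*_ (R-remove (y zero) (y ∘ suc) j) (V-remove (y ∘ suc) j) ⟩
    (y zero - y (suc j)) * R (y zero) rest * (sgn j * (R (y (suc j)) rest * V rest))
      ≡⟨ lemma (y zero) (y (suc j)) (R (y zero) rest) (sgn j) (R (y (suc j)) rest) (V rest) ⟩
    - sgn j * ((y (suc j) - y zero) * R (y (suc j)) rest * (R (y zero) rest * V rest)) ∎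
    where
    rest = y ∘ suc ∘ punchIn j
    lemma : ∀ a b r s q v → (a - b) * r * (s * (q * v)) ≡ - s * ((b - a) * q * (r * v))
    lemma = solve-∀

  V-update : ∀ {n} (y : Fin (suc n) → ℤ) j t →
             V (y [ j ]≔ t) ≡ sgn j * (R t (y ∘ punchIn j) * V (y ∘ punchIn j))
  V-update y j t = trans (V-remove (y [ j ]≔ t) j)
    (cong (sgn j *_) (cong₂ _*_ (R-cong (updateAt-updates j y) rest) (V-cong rest)))
    where
    rest : ∀ i → (y [ j ]≔ t) (punchIn j i) ≡ y (punchIn j i)
    rest i = updateAt-minimal (punchIn j i) j y (punchInᵢ≢i j i)

  R-Deg : ∀ {n} (y : Fin n → ℤ) → Deg (suc n) (λ t → R t y)
  R-Deg {zero}  y = Deg-const 0 1ℤ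
  R-Deg {suc n} y = Deg-linear (suc n) (y zero) (R-Deg (y ∘ suc))

  -- By `V-update` the new value enters only through the `n - 1` linear factors of `R`.
  V-update-Deg : ∀ {n} (y : Fin n → ℤ) j → Deg n (λ t → V (y [ j ]≔ t))
  V-update-Deg {suc n} y j = Deg-cong (suc n) (λ t → trans (lemma (sgn j) (V rest) (R t rest)) (sym (V-update y j t)))
    (Deg-* (suc n) (sgn j * V rest) (R-Deg rest))
    where
    rest = y ∘ punchIn j
    lemma : ∀ s v r → s * v * r ≡ s * (r * v)
    lemma = solve-∀

  R-root : ∀ {n} t (y : Fin n → ℤ) i → y i ≡ t → R t y ≡ 0ℤ
  R-root {suc n} t y i refl = trans (R-remove t y i) (cong (_* R t (y ∘ punchIn i)) (ℤ.+-inverseʳ t))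

  V-update-repeat : ∀ {n} (y : Fin n → ℤ) {j k} → j ≢ k → V (y [ j ]≔ y k) ≡ 0ℤ
  V-update-repeat {suc n} y {j} {k} j≢k = trans (V-update y j (y k))
    (trans (cong (λ r → sgn j * (r * V (y ∘ punchIn j)))
             (R-root (y k) (y ∘ punchIn j) (punchOut j≢k) (cong y (punchIn-punchOut j≢k))))
           (ℤ.*-zeroʳ (sgn j)))

  V-update-self : ∀ {n} (y : Fin n → ℤ) j → V (y [ j ]≔ y j) ≡ V y
  V-update-self {suc n} y j = trans (V-update y j (y j)) (sym (V-remove y j))

  V≢0 : ∀ {n} (y : Fin n → ℤ) → Injective y → V y ≢ 0ℤ
  V≢0 {suc n} y inj eq with ℤ.i*j≡0⇒i≡0∨j≡0 (R (y zero) (y ∘ suc)) eq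
  ... | inj₂ p = V≢0 (y ∘ suc) (suc-injective ∘ inj) p
  ... | inj₁ p = R≢0 (y ∘ suc) (λ i q → case (inj q)) p
    where
    case : ∀ {i : Fin n} → zero ≢ suc i
    case ()
    R≢0 : ∀ {m} (z : Fin m → ℤ) → (∀ i → y zero ≢ z i) → R (y zero) z ≢ 0ℤ
    R≢0 {zero}  z ne ()
    R≢0 {suc m} z ne q with ℤ.i*j≡0⇒i≡0∨j≡0 (y zero - z zero) q
    ... | inj₁ q₁ = ne zero (ℤ.i-j≡0⇒i≡j (y zero) (z zero) q₁)
    ... | inj₂ q₂ = R≢0 (z ∘ suc) (ne ∘ suc) q₂

  -- Swaps of two variables.

  -- A relation rather than an operation, so that restricting both functions to a block gives a swap
  -- again. For `i ≡ j` it forces `x′` to agree with `x`.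
  record IsSwap {n} (i j : Fin n) (x x′ : Fin n → ℤ) : Set where
    constructor swap
    field
      atˡ   : x′ i ≡ x j
      atʳ   : x′ j ≡ x i
      other : ∀ k → k ≢ i → k ≢ j → x′ k ≡ x k
  open IsSwap

  IsSwap-sym : ∀ {n} {i j : Fin n} {x x′} → IsSwap i j x x′ → IsSwap j i x x′
  IsSwap-sym (swap p q r) = swap q p (λ k k≢j k≢i → r k k≢i k≢j)

  IsSwap-suc : ∀ {n} {i j : Fin n} {x x′} → IsSwap (suc i) (suc j) x x′ → IsSwap i j (x ∘ suc) (x′ ∘ suc)
  IsSwap-suc (swap p q r) = swap p q (λ k k≢i k≢j → r (suc k) (k≢i ∘ suc-injective) (k≢j ∘ suc-injective))

  IsSwap-rest : ∀ {n} {j : Fin (suc n)} {x x′} → IsSwap zero (suc j) x x′ →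
                ∀ k → x′ (suc (punchIn j k)) ≡ x (suc (punchIn j k))
  IsSwap-rest {j = j} (swap _ _ r) k = r (suc (punchIn j k)) (λ ()) (punchInᵢ≢i j k ∘ suc-injective)

  R-swap₀ : ∀ {n} t {j : Fin n} {x x′} → IsSwap zero (suc j) x x′ → R t x′ ≡ R t x
  R-swap₀ {suc n} t {j} {x} {x′} s = begin
    (t - x′ zero) * R t (x′ ∘ suc)
      ≡⟨ cong ((t - x′ zero) *_) (R-remove t (x′ ∘ suc) j) ⟩
    (t - x′ zero) * ((t - x′ (suc j)) * R t (x′ ∘ suc ∘ punchIn j))
      ≡⟨ cong₂ _*_ (cong (λ c → t - c) (atˡ s))
           (cong₂ _*_ (cong (λ c → t - c) (atʳ s)) (R-cong {s = t} refl (IsSwap-rest s))) ⟩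
    (t - x (suc j)) * ((t - x zero) * R t (x ∘ suc ∘ punchIn j))
      ≡⟨ lemma (t - x (suc j)) (t - x zero) (R t (x ∘ suc ∘ punchIn j)) ⟩
    (t - x zero) * ((t - x (suc j)) * R t (x ∘ suc ∘ punchIn j))
      ≡⟨ cong ((t - x zero) *_) (R-remove t (x ∘ suc) j) ⟨
    (t - x zero) * R t (x ∘ suc) ∎
    where
    lemma : ∀ a b c → a * (b * c) ≡ b * (a * c)
    lemma = solve-∀

  R-swap : ∀ {n} t {i j : Fin n} {x x′} → i ≢ j → IsSwap i j x x′ → R t x′ ≡ R t x
  R-swap t {zero}  {zero}  i≢j s = contradiction refl i≢j
  R-swap t {zero}  {suc j} i≢j s = R-swap₀ t s
  R-swap t {suc i} {zero}  i≢j s = R-swap₀ t (IsSwap-sym s)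
  R-swap t {suc i} {suc j} i≢j s = cong₂ _*_ (cong (λ c → t - c) (other s zero (λ ()) (λ ())))
                                             (R-swap t (i≢j ∘ cong suc) (IsSwap-suc s))

  -- With both swapped variables in front, the product is their difference, which changes sign,
  -- times an expression symmetric in the two.
  V-swap₀ : ∀ {n} {j : Fin n} {x x′} → IsSwap zero (suc j) x x′ → V x′ ≡ - V x
  V-swap₀ {suc n} {j} {x} {x′} s = begin
    V x′
      ≡⟨ expand x′ ⟩
    (x′ zero - x′ (suc j)) * (sgn j * (R (x′ zero) (rest x′) * (R (x′ (suc j)) (rest x′) * V (rest x′))))
      ≡⟨ cong₂ _*_ (cong₂ _-_ (atˡ s) (atʳ s))
          (cong (sgn j *_) (cong₂ _*_ (R-cong (atˡ s) (IsSwap-rest s))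
                                      (cong₂ _*_ (R-cong (atʳ s) (IsSwap-rest s)) (V-cong (IsSwap-rest s))))) ⟩
    (x (suc j) - x zero) * (sgn j * (R (x (suc j)) (rest x) * (R (x zero) (rest x) * V (rest x))))
      ≡⟨ antisym (x zero) (x (suc j)) (sgn j) (R (x zero) (rest x)) (R (x (suc j)) (rest x)) (V (rest x)) ⟩
    - ((x zero - x (suc j)) * (sgn j * (R (x zero) (rest x) * (R (x (suc j)) (rest x) * V (rest x)))))
      ≡⟨ cong -_ (expand x) ⟨
    - V x ∎
    where
    rest : (Fin (suc (suc n)) → ℤ) → Fin n → ℤ
    rest y = y ∘ suc ∘ punchIn j
    assoc : ∀ a r s q v → a * r * (s * (q * v)) ≡ a * (s * (r * (q * v)))
    assoc = solve-∀
    expand : ∀ y → V y ≡ (y zero - y (suc j)) * (sgn j * (R (y zero) (rest y) * (R (y (suc j)) (rest y) * V (rest y))))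
    expand y = trans (cong₂ _*_ (R-remove (y zero) (y ∘ suc) j) (V-remove (y ∘ suc) j))
                     (assoc (y zero - y (suc j)) (R (y zero) (rest y)) (sgn j) (R (y (suc j)) (rest y)) (V (rest y)))
    antisym : ∀ a b s r q v → (b - a) * (s * (q * (r * v))) ≡ - ((a - b) * (s * (r * (q * v))))
    antisym = solve-∀

  V-swap : ∀ {n} {i j : Fin n} {x x′} → i ≢ j → IsSwap i j x x′ → V x′ ≡ - V x
  V-swap {i = zero}  {zero}  i≢j s = contradiction refl i≢j
  V-swap {i = zero}  {suc j} i≢j s = V-swap₀ s
  V-swap {i = suc i} {zero}  i≢j s = V-swap₀ (IsSwap-sym s)
  V-swap {i = suc i} {suc j} {x} {x′} i≢j s = begin
    R (x′ zero) (x′ ∘ suc) * V (x′ ∘ suc)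
      ≡⟨ cong₂ _*_ (trans (cong (λ t → R t (x′ ∘ suc)) (other s zero (λ ()) (λ ()))) (R-swap (x zero) i≢j′ (IsSwap-suc s)))
                   (V-swap i≢j′ (IsSwap-suc s)) ⟩
    R (x zero) (x ∘ suc) * - V (x ∘ suc)
      ≡⟨ ℤ.neg-distribʳ-* (R (x zero) (x ∘ suc)) (V (x ∘ suc)) ⟨
    - (R (x zero) (x ∘ suc) * V (x ∘ suc)) ∎
    where
    i≢j′ : i ≢ j
    i≢j′ = i≢j ∘ cong suc

  -- Finite sums, interpolation and exchanges between two blocks.

  sum-const : ∀ {n} (f : Fin n → ℤ) b → (∀ i → f i ≡ b) → sum f ≡ pos n * b
  sum-const {zero}  f b eq = refl
  sum-const {suc n} f b eq = trans (cong₂ _+_ (eq zero) (sum-const (f ∘ suc) b (eq ∘ suc))) (sym (ℤ.suc-* (pos n) b))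

  sum-constExcept : ∀ {n} (f : Fin n → ℤ) k b → (∀ i → i ≢ k → f i ≡ b) → sum f ≡ f k + (pos n - 1ℤ) * b
  sum-constExcept {suc n} f k b eq = begin
    sum f                          ≡⟨ sum-remove {i = k} f ⟩
    f k + sum (f ∘ punchIn k)      ≡⟨ cong (λ c → f k + c) (sum-const _ b (λ i → eq (punchIn k i) (punchInᵢ≢i k i))) ⟩
    f k + pos n * b                ≡⟨ lemma (f k) (pos n) b ⟩
    f k + (1ℤ + pos n - 1ℤ) * b ∎
    where
    lemma : ∀ a n b → a + n * b ≡ a + (1ℤ + n - 1ℤ) * b
    lemma = solve-∀

  ∑-↑ : ∀ m {n} (f : Fin (m ℕ.+ n) → ℤ) → sum f ≡ ∑[ i < m ] f (i ↑ˡ n) + ∑[ j < n ] f (m ↑ʳ j)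
  ∑-↑ zero    f = sym (ℤ.+-identityˡ _)
  ∑-↑ (suc m) f = trans (cong (λ c → f zero + c) (∑-↑ m (f ∘ suc))) (sym (ℤ.+-assoc (f zero) _ _))

  ∑∑-cong : ∀ {m n} {f g : Fin m → Fin n → ℤ} → (∀ i j → f i j ≡ g i j) →
            ∑[ i < m ] ∑[ j < n ] f i j ≡ ∑[ i < m ] ∑[ j < n ] g i j
  ∑∑-cong eq = sum-cong-≗ (λ i → sum-cong-≗ (eq i))

  ∑∑-*ˡ : ∀ {m n} c (f : Fin m → Fin n → ℤ) →
          ∑[ i < m ] ∑[ j < n ] (c * f i j) ≡ c * (∑[ i < m ] ∑[ j < n ] f i j)
  ∑∑-*ˡ c f = sym (trans (*-distribˡ-sum c (λ i → sum (f i))) (sum-cong-≗ (λ i → *-distribˡ-sum c (f i))))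

  -- Lagrange interpolation, with denominators cleared by the Vandermonde product.
  interpolation : ∀ {n g} → Deg n g → (y : Fin n → ℤ) → Injective y → ∀ t →
                  ∑[ i < n ] (g (y i) * V (y [ i ]≔ t)) ≡ g t * V y
  interpolation {n} {g} G y inj t = ℤ.i-j≡0⇒i≡j (interp t) (g t * V y)
    (trans (cong (λ c → interp t + c) (flip (g t) (V y))) (roots⇒zero n deg y inj root t))
    where
    interp : ℤ → ℤ
    interp t = ∑[ i < n ] (g (y i) * V (y [ i ]≔ t))
    flip : ∀ a b → - (a * b) ≡ (- b) * a
    flip = solve-∀
    deg : Deg n (λ t → interp t + (- V y) * g t)
    deg = Deg-+ n (Deg-∑ n _ (λ i → Deg-* n (g (y i)) (V-update-Deg y i))) (Deg-* n (- V y) G)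
    lemma : ∀ a b c → a * b + (c - 1ℤ) * 0ℤ + (- b) * a ≡ 0ℤ
    lemma = solve-∀
    root : ∀ k → interp (y k) + (- V y) * g (y k) ≡ 0ℤ
    root k = trans (cong (λ c → c + (- V y) * g (y k))
      (trans (sum-constExcept (λ i → g (y i) * V (y [ i ]≔ y k)) k 0ℤ
               (λ i i≢k → trans (cong (g (y i) *_) (V-update-repeat y i≢k)) (ℤ.*-zeroʳ (g (y i)))))
             (cong (λ c → g (y k) * c + (pos n - 1ℤ) * 0ℤ) (V-update-self y k))))
      (lemma (g (y k)) (V y) (pos n))

  -- As a function of `t`, `V (z [ j ]≔ t)` has degree below `q`, hence below `p`, so its values at
  -- the `p` nodes `y i` determine it; at `t = z j` it is `V z`.
  exchange-one : ∀ {p q} → q ℕ.≤ p → (y : Fin p → ℤ) (z : Fin q → ℤ) → Injective y → ∀ j →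
                 ∑[ i < p ] (V (z [ j ]≔ y i) * V (y [ i ]≔ z j)) ≡ V z * V y
  exchange-one {p} q≤p y z inj j = trans
    (interpolation (Deg-≤ q≤p (V-update-Deg z j)) y inj (z j))
    (cong (_* V y) (V-update-self z j))

  -- For each position of the shorter block, summing over the longer one gives `V y * V z` by
  -- interpolation; the shorter block has `p ⊓ q` positions.
  exchange : ∀ {p q} (y : Fin p → ℤ) (z : Fin q → ℤ) → Injective y → Injective z →
             ∑[ i < p ] ∑[ j < q ] (V (y [ i ]≔ z j) * V (z [ j ]≔ y i)) ≡ pos (p ⊓ q) * (V y * V z)
  exchange {p} {q} y z inj-y inj-z with ℕ.≤-total p q
  ... | inj₁ p≤q = trans (sum-const _ (V y * V z) (λ i → exchange-one p≤q z y inj-z i))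
                         (cong (λ n → pos n * (V y * V z)) (sym (ℕ.m≤n⇒m⊓n≡m p≤q)))
  ... | inj₂ q≤p = begin
    ∑[ i < p ] ∑[ j < q ] (V (y [ i ]≔ z j) * V (z [ j ]≔ y i))
      ≡⟨ ∑-comm (λ i j → V (y [ i ]≔ z j) * V (z [ j ]≔ y i)) ⟩
    ∑[ j < q ] ∑[ i < p ] (V (y [ i ]≔ z j) * V (z [ j ]≔ y i))
      ≡⟨ ∑∑-cong (λ j i → ℤ.*-comm (V (y [ i ]≔ z j)) (V (z [ j ]≔ y i))) ⟩
    ∑[ j < q ] ∑[ i < p ] (V (z [ j ]≔ y i) * V (y [ i ]≔ z j))
      ≡⟨ sum-const _ (V z * V y) (λ j → exchange-one q≤p y z inj-y j) ⟩
    pos q * (V z * V y)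
      ≡⟨ cong₂ (λ n v → pos n * v) (sym (ℕ.m≥n⇒m⊓n≡n q≤p)) (ℤ.*-comm (V z) (V y)) ⟩
    pos (p ⊓ q) * (V y * V z) ∎

  -- Specht polynomials under swaps of positions.

  -- Blocks of consecutive positions, playing the role of the columns of a tableau:
  -- specht is the Specht polynomial.
  specht : ∀ hs → (Fin (total hs) → ℤ) → ℤ
  specht []       x = 1ℤ
  specht (h ∷ hs) x = V (x ∘ (_↑ˡ total hs)) * specht hs (x ∘ (h ↑ʳ_))

  specht-cong : ∀ hs {x y} → x ≗ y → specht hs x ≡ specht hs y
  specht-cong []       x≗y = refl
  specht-cong (h ∷ hs) x≗y = cong₂ _*_ (V-cong (x≗y ∘ (_↑ˡ total hs))) (specht-cong hs (x≗y ∘ (h ↑ʳ_)))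

  ↑ˡ≢↑ʳ : ∀ {m n} {i : Fin m} {j : Fin n} → i ↑ˡ n ≢ m ↑ʳ j
  ↑ˡ≢↑ʳ {m} {n} {i} {j} eq with trans (sym (splitAt-↑ˡ m i n)) (trans (cong (splitAt m) eq) (splitAt-↑ʳ m n j))
  ... | ()

  specht≢0 : ∀ hs x → Injective x → specht hs x ≢ 0ℤ
  specht≢0 []       x inj ()
  specht≢0 (h ∷ hs) x inj eq with ℤ.i*j≡0⇒i≡0∨j≡0 (V (x ∘ (_↑ˡ total hs))) eq
  ... | inj₁ p = V≢0 (x ∘ (_↑ˡ total hs)) (↑ˡ-injective _ _ _ ∘ inj) p
  ... | inj₂ p = specht≢0 hs (x ∘ (h ↑ʳ_)) (↑ʳ-injective _ _ _ ∘ inj) p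

  update-unique : ∀ {n} {x x′ : Fin n → ℤ} {j s} → x′ j ≡ s → (∀ k → k ≢ j → x′ k ≡ x k) → x′ ≗ x [ j ]≔ s
  update-unique {x = x} {j = j} here there k with k ≟ j
  ... | yes refl = trans here (sym (updateAt-updates j x))
  ... | no k≢j = trans (there k k≢j) (sym (updateAt-minimal k j x k≢j))

  specht-updateˡ : ∀ h hs (x : Fin (total (h ∷ hs)) → ℤ) i s →
              specht (h ∷ hs) (x [ i ↑ˡ total hs ]≔ s) ≡ V ((x ∘ (_↑ˡ total hs)) [ i ]≔ s) * specht hs (x ∘ (h ↑ʳ_))
  specht-updateˡ h hs x i s = cong₂ _*_
    (V-cong (update-unique (updateAt-updates (i ↑ˡ total hs) x)
      (λ k k≢i → updateAt-minimal (k ↑ˡ total hs) (i ↑ˡ total hs) x (k≢i ∘ ↑ˡ-injective _ k i))))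
    (specht-cong hs (λ k → updateAt-minimal (h ↑ʳ k) (i ↑ˡ total hs) x (↑ˡ≢↑ʳ ∘ sym)))

  specht-updateʳ : ∀ h hs (x : Fin (total (h ∷ hs)) → ℤ) j s →
              specht (h ∷ hs) (x [ h ↑ʳ j ]≔ s) ≡ V (x ∘ (_↑ˡ total hs)) * specht hs ((x ∘ (h ↑ʳ_)) [ j ]≔ s)
  specht-updateʳ h hs x j s = cong₂ _*_
    (V-cong (λ k → updateAt-minimal (k ↑ˡ total hs) (h ↑ʳ j) x ↑ˡ≢↑ʳ))
    (specht-cong hs (update-unique (updateAt-updates (h ↑ʳ j) x)
      (λ k k≢j → updateAt-minimal (h ↑ʳ k) (h ↑ʳ j) x (k≢j ∘ ↑ʳ-injective _ k j))))

  ∑min : ℕ → List ℕ → ℕ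
  ∑min h []        = 0
  ∑min h (h′ ∷ hs) = h ⊓ h′ ℕ.+ ∑min h hs

  -- A swap with one block of `hs` leaves the others alone; their factors come out of the sum and
  -- `exchange` applies block by block.
  exchange-blocks : ∀ hs {h} (y : Fin h → ℤ) (z : Fin (total hs) → ℤ) → Injective y → Injective z →
                    ∑[ i < h ] ∑[ j < total hs ] (V (y [ i ]≔ z j) * specht hs (z [ j ]≔ y i)) ≡
                    pos (∑min h hs) * (V y * specht hs z)
  exchange-blocks []        {h} y z inj-y inj-z = trans (sum-const {h} (λ _ → 0ℤ) 0ℤ (λ _ → refl)) (ℤ.*-zeroʳ (pos h))
  exchange-blocks (h′ ∷ hs) {h} y z inj-y inj-z = begin
    ∑[ i < h ] ∑[ j < h′ ℕ.+ m ] F i j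
      ≡⟨ sum-cong-≗ (λ i → ∑-↑ h′ (F i)) ⟩
    ∑[ i < h ] (∑[ j < h′ ] F i (j ↑ˡ m) + ∑[ j < m ] F i (h′ ↑ʳ j))
      ≡⟨ ∑-distrib-+ (λ i → ∑[ j < h′ ] F i (j ↑ˡ m)) (λ i → ∑[ j < m ] F i (h′ ↑ʳ j)) ⟩
    ∑[ i < h ] ∑[ j < h′ ] F i (j ↑ˡ m) + ∑[ i < h ] ∑[ j < m ] F i (h′ ↑ʳ j)
      ≡⟨ cong₂ _+_ (∑∑-cong left) (∑∑-cong right) ⟩
    ∑[ i < h ] ∑[ j < h′ ] (specht hs zʳ * A i j) + ∑[ i < h ] ∑[ j < m ] (V zˡ * B i j)
      ≡⟨ cong₂ _+_ (∑∑-*ˡ (specht hs zʳ) A) (∑∑-*ˡ (V zˡ) B) ⟩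
    specht hs zʳ * (∑[ i < h ] ∑[ j < h′ ] A i j) + V zˡ * (∑[ i < h ] ∑[ j < m ] B i j)
      ≡⟨ cong₂ _+_ (cong (specht hs zʳ *_) (exchange y zˡ inj-y (↑ˡ-injective _ _ _ ∘ inj-z)))
                   (cong (V zˡ *_) (exchange-blocks hs y zʳ inj-y (↑ʳ-injective _ _ _ ∘ inj-z))) ⟩
    specht hs zʳ * (pos (h ⊓ h′) * (V y * V zˡ)) + V zˡ * (pos (∑min h hs) * (V y * specht hs zʳ))
      ≡⟨ collect (specht hs zʳ) (pos (h ⊓ h′)) (V y) (V zˡ) (pos (∑min h hs)) ⟩
    (pos (h ⊓ h′) + pos (∑min h hs)) * (V y * (V zˡ * specht hs zʳ)) ∎
    where
    m : ℕ
    m = total hs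
    zˡ : Fin h′ → ℤ
    zˡ = z ∘ (_↑ˡ m)
    zʳ : Fin m → ℤ
    zʳ = z ∘ (h′ ↑ʳ_)
    F : Fin h → Fin (h′ ℕ.+ m) → ℤ
    F i j = V (y [ i ]≔ z j) * specht (h′ ∷ hs) (z [ j ]≔ y i)
    A : Fin h → Fin h′ → ℤ
    A i j = V (y [ i ]≔ zˡ j) * V (zˡ [ j ]≔ y i)
    B : Fin h → Fin m → ℤ
    B i j = V (y [ i ]≔ zʳ j) * specht hs (zʳ [ j ]≔ y i)
    rot : ∀ a b c → a * (b * c) ≡ c * (a * b)
    rot = solve-∀
    left : ∀ i j → F i (j ↑ˡ m) ≡ specht hs zʳ * A i j
    left i j = trans (cong (V (y [ i ]≔ zˡ j) *_) (specht-updateˡ h′ hs z j (y i)))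
      (rot (V (y [ i ]≔ zˡ j)) (V (zˡ [ j ]≔ y i)) (specht hs zʳ))
    rot′ : ∀ a b c → a * (b * c) ≡ b * (a * c)
    rot′ = solve-∀
    right : ∀ i j → F i (h′ ↑ʳ j) ≡ V zˡ * B i j
    right i j = trans (cong (V (y [ i ]≔ zʳ j) *_) (specht-updateʳ h′ hs z j (y i)))
      (rot′ (V (y [ i ]≔ zʳ j)) (V zˡ) (specht hs (zʳ [ j ]≔ y i)))
    collect : ∀ p a v w b → p * (a * (v * w)) + w * (b * (v * p)) ≡ (a + b) * (v * (w * p))
    collect = solve-∀

  -- Twice the content sum of the diagram with column heights hs, plus its size.
  eig : List ℕ → ℤ
  eig []       = 0ℤ
  eig (h ∷ hs) = pos h * (pos 2 - pos h) + pos 2 * pos (∑min h hs) + eig hs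

  IsSwap-refl : ∀ {n} {i : Fin n} {x x′} → IsSwap i i x x′ → x′ ≗ x
  IsSwap-refl {i = i} s k with k ≟ i
  ... | yes refl = atˡ s
  ... | no k≢i = other s k k≢i k≢i

  -- In each row the diagonal term is `V y` and each of the other `h - 1` terms is `- V y`.
  swap-sum-within : ∀ {h} (y : Fin h → ℤ) (F : Fin h → Fin h → Fin h → ℤ) → (∀ i j → IsSwap i j y (F i j)) →
                    ∑[ i < h ] ∑[ j < h ] V (F i j) ≡ pos h * (pos 2 - pos h) * V y
  swap-sum-within {h} y F s = trans (sum-const _ ((pos 2 - pos h) * V y) row) (sym (ℤ.*-assoc (pos h) (pos 2 - pos h) (V y)))
    where
    lemma : ∀ v h → v + (h - 1ℤ) * - v ≡ (pos 2 - h) * v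
    lemma = solve-∀
    row : ∀ i → ∑[ j < h ] V (F i j) ≡ (pos 2 - pos h) * V y
    row i = begin
      ∑[ j < h ] V (F i j)             ≡⟨ sum-constExcept (λ j → V (F i j)) i (- V y) (λ j j≢i → V-swap (j≢i ∘ sym) (s i j)) ⟩
      V (F i i) + (pos h - 1ℤ) * - V y ≡⟨ cong (λ c → c + (pos h - 1ℤ) * - V y) (V-cong (IsSwap-refl (s i i))) ⟩
      V y + (pos h - 1ℤ) * - V y       ≡⟨ lemma (V y) (pos h) ⟩
      (pos 2 - pos h) * V y ∎

  swap-sum-across : ∀ h hs (x : Fin (total (h ∷ hs)) → ℤ) (F : Fin h → Fin (total hs) → Fin (total (h ∷ hs)) → ℤ) →
                    (∀ i j → IsSwap (i ↑ˡ total hs) (h ↑ʳ j) x (F i j)) → Injective x →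
                    ∑[ i < h ] ∑[ j < total hs ] specht (h ∷ hs) (F i j) ≡ pos (∑min h hs) * specht (h ∷ hs) x
  swap-sum-across h hs x F s inj = trans
    (∑∑-cong (λ i j → cong₂ _*_
      (V-cong (update-unique (atˡ (s i j)) (λ k k≢i → other (s i j) (k ↑ˡ total hs) (k≢i ∘ ↑ˡ-injective _ k i) ↑ˡ≢↑ʳ)))
      (specht-cong hs (update-unique (atʳ (s i j)) (λ k k≢j → other (s i j) (h ↑ʳ k) (↑ˡ≢↑ʳ ∘ sym) (k≢j ∘ ↑ʳ-injective _ k j))))))
    (exchange-blocks hs _ _ (↑ˡ-injective _ _ _ ∘ inj) (↑ʳ-injective _ _ _ ∘ inj))

  -- Summing over all ordered pairs, diagonal included, gives four quadrants: within the first
  -- block, twice across, and within the rest. The two mixed ones agree, whence the factor 2 in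
  -- `eig`.
  swap-sum : ∀ hs (x : Fin (total hs) → ℤ) (F : Fin (total hs) → Fin (total hs) → Fin (total hs) → ℤ) →
             (∀ i j → IsSwap i j x (F i j)) → Injective x →
             ∑[ i < total hs ] ∑[ j < total hs ] specht hs (F i j) ≡ eig hs * specht hs x
  swap-sum []       x F s inj = refl
  swap-sum (h ∷ hs) x F s inj = begin
    ∑[ i < h ℕ.+ m ] ∑[ j < h ℕ.+ m ] G i j
      ≡⟨ ∑-↑ h (λ i → ∑[ j < h ℕ.+ m ] G i j) ⟩
    ∑[ i < h ] ∑[ j < h ℕ.+ m ] G (i ↑ˡ m) j + ∑[ i < m ] ∑[ j < h ℕ.+ m ] G (h ↑ʳ i) j
      ≡⟨ cong₂ _+_ (halves (λ i → G (i ↑ˡ m))) (halves (λ i → G (h ↑ʳ i))) ⟩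
    (∑[ i < h ] ∑[ j < h ] G (i ↑ˡ m) (j ↑ˡ m) + ∑[ i < h ] ∑[ j < m ] G (i ↑ˡ m) (h ↑ʳ j)) +
    (∑[ i < m ] ∑[ j < h ] G (h ↑ʳ i) (j ↑ˡ m) + ∑[ i < m ] ∑[ j < m ] G (h ↑ʳ i) (h ↑ʳ j))
      ≡⟨ cong₂ _+_ (cong₂ _+_ LL LR) (cong₂ _+_ RL RR) ⟩
    (p * (pos h * (pos 2 - pos h) * v) + o * (v * p)) + (o * (v * p) + v * (eig hs * p))
      ≡⟨ collect (pos h) v p o (eig hs) ⟩
    eig (h ∷ hs) * (v * p) ∎
    where
    m : ℕ
    m = total hs
    v p o : ℤ
    v = V (x ∘ (_↑ˡ m))
    p = specht hs (x ∘ (h ↑ʳ_))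
    o = pos (∑min h hs)
    G : Fin (h ℕ.+ m) → Fin (h ℕ.+ m) → ℤ
    G i j = specht (h ∷ hs) (F i j)
    halves : ∀ {k} (H : Fin k → Fin (h ℕ.+ m) → ℤ) →
             ∑[ i < k ] ∑[ j < h ℕ.+ m ] H i j ≡ ∑[ i < k ] ∑[ j < h ] H i (j ↑ˡ m) + ∑[ i < k ] ∑[ j < m ] H i (h ↑ʳ j)
    halves H = trans (sum-cong-≗ (λ i → ∑-↑ h (H i))) (∑-distrib-+ (λ i → ∑[ j < h ] H i (j ↑ˡ m)) (λ i → ∑[ j < m ] H i (h ↑ʳ j)))
    swapˡ : ∀ i j → IsSwap i j (x ∘ (_↑ˡ m)) (F (i ↑ˡ m) (j ↑ˡ m) ∘ (_↑ˡ m))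
    swapˡ i j = swap (atˡ (s _ _)) (atʳ (s _ _))
      (λ k k≢i k≢j → other (s _ _) (k ↑ˡ m) (k≢i ∘ ↑ˡ-injective _ _ _) (k≢j ∘ ↑ˡ-injective _ _ _))
    swapʳ : ∀ i j → IsSwap i j (x ∘ (h ↑ʳ_)) (F (h ↑ʳ i) (h ↑ʳ j) ∘ (h ↑ʳ_))
    swapʳ i j = swap (atˡ (s _ _)) (atʳ (s _ _))
      (λ k k≢i k≢j → other (s _ _) (h ↑ʳ k) (k≢i ∘ ↑ʳ-injective _ _ _) (k≢j ∘ ↑ʳ-injective _ _ _))
    LL : ∑[ i < h ] ∑[ j < h ] G (i ↑ˡ m) (j ↑ˡ m) ≡ p * (pos h * (pos 2 - pos h) * v)
    LL = begin
      ∑[ i < h ] ∑[ j < h ] G (i ↑ˡ m) (j ↑ˡ m)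
        ≡⟨ ∑∑-cong (λ i j → trans (ℤ.*-comm (V (F (i ↑ˡ m) (j ↑ˡ m) ∘ (_↑ˡ m))) _)
             (cong (_* V (F (i ↑ˡ m) (j ↑ˡ m) ∘ (_↑ˡ m)))
               (specht-cong hs (λ k → other (s (i ↑ˡ m) (j ↑ˡ m)) (h ↑ʳ k) (↑ˡ≢↑ʳ ∘ sym) (↑ˡ≢↑ʳ ∘ sym))))) ⟩
      ∑[ i < h ] ∑[ j < h ] (p * V (F (i ↑ˡ m) (j ↑ˡ m) ∘ (_↑ˡ m)))
        ≡⟨ ∑∑-*ˡ p (λ i j → V (F (i ↑ˡ m) (j ↑ˡ m) ∘ (_↑ˡ m))) ⟩
      p * (∑[ i < h ] ∑[ j < h ] V (F (i ↑ˡ m) (j ↑ˡ m) ∘ (_↑ˡ m)))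
        ≡⟨ cong (p *_) (swap-sum-within (x ∘ (_↑ˡ m)) (λ i j → F (i ↑ˡ m) (j ↑ˡ m) ∘ (_↑ˡ m)) swapˡ) ⟩
      p * (pos h * (pos 2 - pos h) * v) ∎
    LR : ∑[ i < h ] ∑[ j < m ] G (i ↑ˡ m) (h ↑ʳ j) ≡ o * (v * p)
    LR = swap-sum-across h hs x (λ i j → F (i ↑ˡ m) (h ↑ʳ j)) (λ i j → s (i ↑ˡ m) (h ↑ʳ j)) inj
    RL : ∑[ i < m ] ∑[ j < h ] G (h ↑ʳ i) (j ↑ˡ m) ≡ o * (v * p)
    RL = trans (∑-comm (λ i j → G (h ↑ʳ i) (j ↑ˡ m)))
      (swap-sum-across h hs x (λ i j → F (h ↑ʳ j) (i ↑ˡ m)) (λ i j → IsSwap-sym (s (h ↑ʳ j) (i ↑ˡ m))) inj)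
    RR : ∑[ i < m ] ∑[ j < m ] G (h ↑ʳ i) (h ↑ʳ j) ≡ v * (eig hs * p)
    RR = begin
      ∑[ i < m ] ∑[ j < m ] G (h ↑ʳ i) (h ↑ʳ j)
        ≡⟨ ∑∑-cong (λ i j → cong (_* specht hs (F (h ↑ʳ i) (h ↑ʳ j) ∘ (h ↑ʳ_)))
             (V-cong (λ k → other (s (h ↑ʳ i) (h ↑ʳ j)) (k ↑ˡ m) ↑ˡ≢↑ʳ ↑ˡ≢↑ʳ))) ⟩
      ∑[ i < m ] ∑[ j < m ] (v * specht hs (F (h ↑ʳ i) (h ↑ʳ j) ∘ (h ↑ʳ_)))
        ≡⟨ ∑∑-*ˡ v (λ i j → specht hs (F (h ↑ʳ i) (h ↑ʳ j) ∘ (h ↑ʳ_))) ⟩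
      v * (∑[ i < m ] ∑[ j < m ] specht hs (F (h ↑ʳ i) (h ↑ʳ j) ∘ (h ↑ʳ_)))
        ≡⟨ cong (v *_) (swap-sum hs (x ∘ (h ↑ʳ_)) (λ i j → F (h ↑ʳ i) (h ↑ʳ j) ∘ (h ↑ʳ_)) swapʳ (↑ʳ-injective _ _ _ ∘ inj)) ⟩
      v * (eig hs * p) ∎
    collect : ∀ h v p o e → (p * (h * (pos 2 - h) * v) + o * (v * p)) + (o * (v * p) + v * (e * p)) ≡
              (h * (pos 2 - h) + pos 2 * o + e) * (v * p)
    collect = solve-∀

  -- From integer sums to the rational sums of `adjApply`.

  -- `i / 1` normalises through a gcd and is stuck for a variable `i`; this is the same rational in
  -- a form on which addition and multiplication unfold.
  reduced : ℤ → ℚ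
  reduced i = mkℚ i 0 (ℕ.sym (ℕ.1-coprimeTo _))

  ℤ→ℚ-reduced : ∀ i → ℤ→ℚ i ≡ reduced i
  ℤ→ℚ-reduced i = ℚ.↥p/↧p≡p (reduced i)

  ℤ→ℚ-+ : ∀ i j → ℤ→ℚ (i + j) ≡ ℤ→ℚ i ℚ.+ ℤ→ℚ j
  ℤ→ℚ-+ i j = begin
    ℤ→ℚ (i + j)               ≡⟨ cong₂ (λ a b → ℤ→ℚ (a + b)) (ℤ.*-identityʳ i) (ℤ.*-identityʳ j) ⟨
    reduced i ℚ.+ reduced j   ≡⟨ cong₂ ℚ._+_ (ℤ→ℚ-reduced i) (ℤ→ℚ-reduced j) ⟨
    ℤ→ℚ i ℚ.+ ℤ→ℚ j ∎

  ℤ→ℚ-* : ∀ i j → ℤ→ℚ (i * j) ≡ ℤ→ℚ i ℚ.* ℤ→ℚ j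
  ℤ→ℚ-* i j = cong₂ ℚ._*_ (sym (ℤ→ℚ-reduced i)) (sym (ℤ→ℚ-reduced j))

  ℤ→ℚ≢0 : ∀ {i} → i ≢ 0ℤ → ℤ→ℚ i ≢ 0ℚ
  ℤ→ℚ≢0 {i} i≢0 eq = i≢0 (cong ℚ.↥_ (trans (sym (ℤ→ℚ-reduced i)) eq))

  [_<_]_ : ∀ {n} → Fin n → Fin n → ℤ → ℤ
  [ i < j ] a = if does (toℕ i <? toℕ j) then a else 0ℤ

  sumℚ-++ : ∀ xs ys → sumℚ (xs ++ ys) ≡ sumℚ xs ℚ.+ sumℚ ys
  sumℚ-++ []       ys = sym (ℚ.+-identityˡ _)
  sumℚ-++ (x ∷ xs) ys = trans (cong (x ℚ.+_) (sumℚ-++ xs ys)) (sym (ℚ.+-assoc x _ _))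

  sumℚ-concatMap : ∀ {n} {A : Set} (g : A → ℚ) (f : Fin n → List A) (e : Fin n → ℤ) →
                   (∀ i → sumℚ (map g (f i)) ≡ ℤ→ℚ (e i)) →
                   sumℚ (map g (concatMap f (allFin n))) ≡ ℤ→ℚ (sum e)
  sumℚ-concatMap {n} {A} g f e eq = go n (λ i → i)
    where
    -- Generalised from `allFin n` to `tabulate h`, so that the tail of the list is again an
    -- instance.
    go : ∀ m (h : Fin m → Fin n) → sumℚ (map g (concatMap f (tabulate h))) ≡ ℤ→ℚ (sum (e ∘ h))
    go zero    h = refl
    go (suc m) h = begin
      sumℚ (map g (f (h zero) ++ concatMap f (tabulate (h ∘ suc))))
        ≡⟨ cong sumℚ (map-++ g (f (h zero)) _) ⟩
      sumℚ (map g (f (h zero)) ++ map g (concatMap f (tabulate (h ∘ suc))))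
        ≡⟨ sumℚ-++ (map g (f (h zero))) _ ⟩
      sumℚ (map g (f (h zero))) ℚ.+ sumℚ (map g (concatMap f (tabulate (h ∘ suc))))
        ≡⟨ cong₂ ℚ._+_ (eq (h zero)) (go m (h ∘ suc)) ⟩
      ℤ→ℚ (e (h zero)) ℚ.+ ℤ→ℚ (sum (e ∘ h ∘ suc))
        ≡⟨ ℤ→ℚ-+ (e (h zero)) (sum (e ∘ h ∘ suc)) ⟨
      ℤ→ℚ (sum (e ∘ h)) ∎

  sum-transpositionPairs : ∀ {n} (g : Fin n × Fin n → ℚ) (e : Fin n → Fin n → ℤ) → (∀ i j → g (i , j) ≡ ℤ→ℚ (e i j)) →
                     sumℚ (map g (transpositionPairs n)) ≡ ℤ→ℚ (∑[ i < n ] ∑[ j < n ] ([ i < j ] e i j))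
  sum-transpositionPairs {n} g e eq = sumℚ-concatMap g _ _ (λ i → sumℚ-concatMap g _ _ (λ j → cell i j))
    where
    cell : ∀ i j → sumℚ (map g (if does (toℕ i <? toℕ j) then (i , j) ∷ [] else [])) ≡ ℤ→ℚ ([ i < j ] e i j)
    cell i j with does (toℕ i <? toℕ j)
    ... | true  = trans (ℚ.+-identityʳ _) (eq i j)
    ... | false = refl

  -- Links two ways of summing: `adjApply` takes each pair `i < j` once, the decomposition into
  -- blocks takes all ordered pairs.
  ∑∑-symmetric : ∀ {n} (e : Fin n → Fin n → ℤ) a → (∀ i j → e i j ≡ e j i) → (∀ i → e i i ≡ a) →
                 ∑[ i < n ] ∑[ j < n ] e i j ≡ pos 2 * (∑[ i < n ] ∑[ j < n ] ([ i < j ] e i j)) + pos n * a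
  ∑∑-symmetric {n} e a e-sym e-diag = begin
    ∑[ i < n ] ∑[ j < n ] e i j
      ≡⟨ ∑∑-cong cell ⟩
    ∑[ i < n ] ∑[ j < n ] (L i j + (L j i + D i j))
      ≡⟨ ∑∑-+ L (λ i j → L j i + D i j) ⟩
    ΣL + ∑[ i < n ] ∑[ j < n ] (L j i + D i j)
      ≡⟨ cong (λ c → ΣL + c) (∑∑-+ (λ i j → L j i) D) ⟩
    ΣL + (∑[ i < n ] ∑[ j < n ] L j i + ∑[ i < n ] ∑[ j < n ] D i j)
      ≡⟨ cong (λ c → ΣL + c) (cong₂ _+_ (∑-comm (λ i j → L j i)) diag) ⟩
    ΣL + (ΣL + pos n * a)
      ≡⟨ lemma ΣL (pos n * a) ⟩
    pos 2 * ΣL + pos n * a ∎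
    where
    L D : Fin n → Fin n → ℤ
    L i j = [ i < j ] e i j
    D i j = if does (i ≟ j) then a else 0ℤ
    ΣL : ℤ
    ΣL = ∑[ i < n ] ∑[ j < n ] L i j
    lemma : ∀ s b → s + (s + b) ≡ pos 2 * s + b
    lemma = solve-∀
    ∑∑-+ : ∀ (f g : Fin n → Fin n → ℤ) → ∑[ i < n ] ∑[ j < n ] (f i j + g i j) ≡
           ∑[ i < n ] ∑[ j < n ] f i j + ∑[ i < n ] ∑[ j < n ] g i j
    ∑∑-+ f g = trans (sum-cong-≗ (λ i → ∑-distrib-+ (f i) (g i))) (∑-distrib-+ (λ i → sum (f i)) (λ i → sum (g i)))
    cell : ∀ i j → e i j ≡ L i j + (L j i + D i j)
    cell i j with ℕ.<-cmp (toℕ i) (toℕ j)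
    ... | tri< i<j i≢j j≮i rewrite dec-true (toℕ i <? toℕ j) i<j | dec-false (toℕ j <? toℕ i) j≮i
                                | dec-false (i ≟ j) (i≢j ∘ cong toℕ) = sym (ℤ.+-identityʳ (e i j))
    ... | tri≈ i≮j i≡j j≮i rewrite dec-false (toℕ i <? toℕ j) i≮j | dec-false (toℕ j <? toℕ i) j≮i
                                | dec-true (i ≟ j) (toℕ-injective i≡j) =
          trans (trans (cong (e i) (sym (toℕ-injective i≡j))) (e-diag i)) (lemma′ a)
      where
      lemma′ : ∀ a → a ≡ 0ℤ + (0ℤ + a)
      lemma′ = solve-∀
    ... | tri> i≮j i≢j j<i rewrite dec-false (toℕ i <? toℕ j) i≮j | dec-true (toℕ j <? toℕ i) j<i
                                | dec-false (i ≟ j) (i≢j ∘ cong toℕ) = trans (e-sym i j) (lemma′ (e j i))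
      where
      lemma′ : ∀ a → a ≡ 0ℤ + (a + 0ℤ)
      lemma′ = solve-∀
    unit : ∀ a n → a + (n - 1ℤ) * 0ℤ ≡ a
    unit = solve-∀
    row : ∀ i → ∑[ j < n ] D i j ≡ a
    row i = begin
      ∑[ j < n ] D i j
        ≡⟨ sum-constExcept (D i) i 0ℤ
             (λ j j≢i → cong (λ b → if b then a else 0ℤ) (dec-false (i ≟ j) (j≢i ∘ sym))) ⟩
      D i i + (pos n - 1ℤ) * 0ℤ
        ≡⟨ cong (λ b → (if b then a else 0ℤ) + (pos n - 1ℤ) * 0ℤ) (dec-true (i ≟ i) refl) ⟩
      a + (pos n - 1ℤ) * 0ℤ
        ≡⟨ unit a (pos n) ⟩
      a ∎
    diag : ∑[ i < n ] ∑[ j < n ] D i j ≡ pos n * a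
    diag = sum-const (λ i → sum (D i)) a row

  -- Transpositions and the eigenvector equation.

  transpose-atˡ : ∀ {n} (i j : Fin n) → transpose i j ⟨$⟩ʳ i ≡ j
  transpose-atˡ i j rewrite dec-true (i ≟ i) refl = refl

  transpose-atʳ : ∀ {n} (i j : Fin n) → transpose i j ⟨$⟩ʳ j ≡ i
  transpose-atʳ i j with j ≟ i
  ... | yes j≡i = j≡i
  ... | no _ rewrite dec-true (j ≟ j) refl = refl

  transpose-other : ∀ {n} (i j k : Fin n) → k ≢ i → k ≢ j → transpose i j ⟨$⟩ʳ k ≡ k
  transpose-other i j k k≢i k≢j rewrite dec-false (k ≟ i) k≢i | dec-false (k ≟ j) k≢j = refl

  transpose-comm : ∀ {n} (i j k : Fin n) → transpose i j ⟨$⟩ʳ k ≡ transpose j i ⟨$⟩ʳ k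
  transpose-comm i j k = go (k ≟ i) (k ≟ j)
    where
    go : Dec (k ≡ i) → Dec (k ≡ j) → transpose i j ⟨$⟩ʳ k ≡ transpose j i ⟨$⟩ʳ k
    go (yes refl) _          = trans (transpose-atˡ k j) (sym (transpose-atʳ j k))
    go (no _)     (yes refl) = trans (transpose-atʳ i k) (sym (transpose-atˡ k i))
    go (no k≢i)   (no k≢j)   = trans (transpose-other i j k k≢i k≢j) (sym (transpose-other j i k k≢j k≢i))

  transpose-self : ∀ {n} (i k : Fin n) → transpose i i ⟨$⟩ʳ k ≡ k
  transpose-self i k = go (k ≟ i)
    where
    go : Dec (k ≡ i) → transpose i i ⟨$⟩ʳ k ≡ k
    go (yes refl) = transpose-atˡ k k
    go (no k≢i)   = transpose-other i i k k≢i k≢i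

  values : ∀ {n} → Sym n → Fin n → ℤ
  values f i = pos (toℕ (f ⟨$⟩ʳ i))

  ⟨$⟩ʳ-injective : ∀ {n} (f : Sym n) {i j} → f ⟨$⟩ʳ i ≡ f ⟨$⟩ʳ j → i ≡ j
  ⟨$⟩ʳ-injective f {i} {j} eq = trans (sym (inverseˡ f)) (trans (cong (f ⟨$⟩ˡ_) eq) (inverseˡ f))

  values-injective : ∀ {n} (f : Sym n) → Injective (values f)
  values-injective f eq = ⟨$⟩ʳ-injective f (toℕ-injective (ℤ.+-injective eq))

  -- The transposition acts on the values of `f`, and exchanging the values at `i` and `j` is
  -- exchanging these positions.
  values-transpose : ∀ {n} (f : Sym n) i j → IsSwap i j (values f) (values (f ∘ₚ transpose (f ⟨$⟩ʳ i) (f ⟨$⟩ʳ j)))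
  values-transpose f i j = swap
    (cong (pos ∘ toℕ) (transpose-atˡ (f ⟨$⟩ʳ i) (f ⟨$⟩ʳ j)))
    (cong (pos ∘ toℕ) (transpose-atʳ (f ⟨$⟩ʳ i) (f ⟨$⟩ʳ j)))
    (λ k k≢i k≢j → cong (pos ∘ toℕ) (transpose-other (f ⟨$⟩ʳ i) (f ⟨$⟩ʳ j) (f ⟨$⟩ʳ k)
      (k≢i ∘ ⟨$⟩ʳ-injective f) (k≢j ∘ ⟨$⟩ʳ-injective f)))

  spechtVector : ∀ hs → Vector (total hs)
  spechtVector hs = record
    { entry = λ f → ℤ→ℚ (specht hs (values f))
    ; resp  = λ f≈g → cong ℤ→ℚ (specht-cong hs (λ i → cong (pos ∘ toℕ) (f≈g i)))
    }

  -- In `2 k + n` the factor 2 comes from counting each transposition in both orders, and `n` from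
  -- the diagonal of the double sum.
  eigenvalue : ∀ hs k → pos 2 * k + pos (total hs) ≡ eig hs → IsTranspositionGraphEigenvalue (total hs) (ℤ→ℚ k)
  eigenvalue hs k k-eq = spechtVector hs , (id , ℤ→ℚ≢0 (specht≢0 hs (values id) (values-injective id))) , eigenvector
    where
    n : ℕ
    n = total hs
    eigenvector : ∀ f → adjApply (spechtVector hs) f ≡ ℤ→ℚ k ℚ.* ℤ→ℚ (specht hs (values f))
    eigenvector f = begin
      adjApply (spechtVector hs) f                          ≡⟨ sum-transpositionPairs _ e (λ i j → refl) ⟩
      ℤ→ℚ S                                                 ≡⟨ cong ℤ→ℚ (ℤ.*-cancelˡ-≡ (pos 2) S (k * p) double) ⟩
      ℤ→ℚ (k * p)                                           ≡⟨ ℤ→ℚ-* k p ⟩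
      ℤ→ℚ k ℚ.* ℤ→ℚ p ∎
      where
      e : Fin n → Fin n → ℤ
      e i j = specht hs (values (f ∘ₚ transpose i j))
      S p : ℤ
      S = ∑[ i < n ] ∑[ j < n ] ([ i < j ] e i j)
      p = specht hs (values f)
      all : pos 2 * S + pos n * p ≡ eig hs * p
      all = begin
        pos 2 * S + pos n * p
          ≡⟨ ∑∑-symmetric e p (λ i j → specht-cong hs (λ l → cong (pos ∘ toℕ) (transpose-comm i j (f ⟨$⟩ʳ l))))
                              (λ i → specht-cong hs (λ l → cong (pos ∘ toℕ) (transpose-self i (f ⟨$⟩ʳ l)))) ⟨
        ∑[ i < n ] ∑[ j < n ] e i j
          -- Reindexing both sums along `f` turns pairs of values into pairs of positions, to which
          -- `swap-sum` applies.
          ≡⟨ ∑-permute (λ i → ∑[ j < n ] e i j) f ⟩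
        ∑[ i < n ] ∑[ j < n ] e (f ⟨$⟩ʳ i) j
          ≡⟨ sum-cong-≗ (λ i → ∑-permute (e (f ⟨$⟩ʳ i)) f) ⟩
        ∑[ i < n ] ∑[ j < n ] e (f ⟨$⟩ʳ i) (f ⟨$⟩ʳ j)
          ≡⟨ swap-sum hs (values f) _ (values-transpose f) (values-injective f) ⟩
        eig hs * p ∎
      lemma : ∀ k n p → (pos 2 * k + n) * p ≡ pos 2 * (k * p) + n * p
      lemma = solve-∀
      double : pos 2 * S ≡ pos 2 * (k * p)
      double = ∙-cancelʳ (pos n * p) (pos 2 * S) (pos 2 * (k * p)) (begin
        pos 2 * S + pos n * p        ≡⟨ all ⟩
        eig hs * p                   ≡⟨ cong (_* p) k-eq ⟨
        (pos 2 * k + pos n) * p      ≡⟨ lemma k (pos n) p ⟩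
        pos 2 * (k * p) + pos n * p ∎)

module Diagrams where

  open Eigenvectors using (∑min; eig)
  open import Data.Bool using (true; false; T)
  open import Data.Integer using (ℤ; -_; 0ℤ; 1ℤ; _+_; _*_; _-_; -[1+_]; ∣_∣; _≤_; +≤+; -≤-) renaming (+_ to pos)
  open import Data.Integer.Tactic.RingSolver using (solve-∀)
  open import Data.List.Relation.Unary.All as All using (All; []; _∷_)
  open import Data.Maybe as Maybe using (Maybe; just; nothing; _<∣>_; is-just; to-witness-T)
  open import Data.Nat as ℕ using (ℕ; zero; suc; _∸_; _⊓_; z≤n; s≤s)
  open import Data.Nat.DivMod using (_/_; _%_; m≡m%n+[m/n]*n; m%n<n)
  import Data.Nat.Tactic.RingSolver as ℕ
  open import Relation.Nullary.Decidable using (True; toWitness; _×-dec_)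

  -- Young diagrams: from Frobenius notation to column heights.

  tri : ℕ → ℕ
  tri zero    = 0
  tri (suc a) = suc a ℕ.+ tri a

  2*tri : ∀ a → pos 2 * pos (tri a) ≡ pos a * (pos a + 1ℤ)
  2*tri zero    = refl
  2*tri (suc a) = trans (step (pos a) (pos (tri a))) (trans (cong (λ c → pos 2 * (1ℤ + pos a) + c) (2*tri a)) (last (pos a)))
    where
    step : ∀ a t → pos 2 * ((1ℤ + a) + t) ≡ pos 2 * (1ℤ + a) + pos 2 * t
    step = solve-∀
    last : ∀ a → pos 2 * (1ℤ + a) + a * (a + 1ℤ) ≡ (1ℤ + a) * ((1ℤ + a) + 1ℤ)
    last = solve-∀

  -- Young diagrams in Frobenius notation: Diagram v w n k is the type of diagrams with
  -- n cells and content sum k whose principal hooks have arms < v and legs < w.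
  data Diagram (v w : ℕ) : ℕ → ℤ → Set where
    empty : Diagram v w 0 0ℤ
    hook  : ∀ {m j} a b → a ℕ.< v → b ℕ.< w → Diagram a b m j →
            Diagram v w (suc (a ℕ.+ b ℕ.+ m)) (pos (tri a) - pos (tri b) + j)

  -- The columns inside a hook of arm length hs + r, first column excluded.
  surround : List ℕ → ℕ → List ℕ
  surround []       r = replicate r 1
  surround (h ∷ hs) r = suc h ∷ surround hs r

  total-replicate : ∀ r → total (replicate r 1) ≡ r
  total-replicate zero    = refl
  total-replicate (suc r) = cong suc (total-replicate r)

  total-surround : ∀ hs r → total (surround hs r) ≡ total hs ℕ.+ (length hs ℕ.+ r)
  total-surround []       r = total-replicate r
  total-surround (h ∷ hs) r = trans (cong (λ c → suc h ℕ.+ c) (total-surround hs r)) (lemma h (total hs) (length hs) r)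
    where
    lemma : ∀ h m l r → suc h ℕ.+ (m ℕ.+ (l ℕ.+ r)) ≡ h ℕ.+ m ℕ.+ (suc l ℕ.+ r)
    lemma = ℕ.solve-∀

  ∑min-surround : ∀ h hs r → ∑min (suc h) (surround hs r) ≡ ∑min h hs ℕ.+ (length hs ℕ.+ r)
  ∑min-surround h []        zero    = refl
  ∑min-surround h []        (suc r) = cong₂ ℕ._+_ (cong suc (ℕ.⊓-zeroʳ h)) (∑min-surround h [] r)
  ∑min-surround h (h′ ∷ hs) r = trans (cong (λ c → suc (h ⊓ h′) ℕ.+ c) (∑min-surround h hs r))
                                      (lemma (h ⊓ h′) (∑min h hs) (length hs) r)
    where
    lemma : ∀ h m l r → suc h ℕ.+ (m ℕ.+ (l ℕ.+ r)) ≡ h ℕ.+ m ℕ.+ (suc l ℕ.+ r)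
    lemma = ℕ.solve-∀

  ∑min-All : ∀ {h hs} → All (ℕ._≤ h) hs → ∑min h hs ≡ total hs
  ∑min-All []         = refl
  ∑min-All (p ∷ ps) = cong₂ ℕ._+_ (ℕ.m≥n⇒m⊓n≡n p) (∑min-All ps)

  -- A new top row of `l = length hs + r` cells lowers the content of every old cell by 1 and adds
  -- the contents 0 to `l - 1`. As `eig` is twice the content sum plus the size, the old cells lose
  -- `2 * total hs` and the row gives `l (l - 1) + l = l * l`.
  eig-surround : ∀ hs r → eig (surround hs r) ≡ eig hs - pos 2 * pos (total hs) + pos (length hs ℕ.+ r) * pos (length hs ℕ.+ r)
  eig-surround [] zero    = refl
  eig-surround [] (suc r) = trans
    (cong₂ (λ a b → 1ℤ * (pos 2 - 1ℤ) + pos 2 * pos a + b) (∑min-surround 0 [] r) (eig-surround [] r))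
    (lemma (pos r))
    where
    lemma : ∀ r → 1ℤ * (pos 2 - 1ℤ) + pos 2 * r + (0ℤ - pos 2 * 0ℤ + r * r) ≡ 0ℤ - pos 2 * 0ℤ + (1ℤ + r) * (1ℤ + r)
    lemma = solve-∀
  eig-surround (h ∷ hs) r = trans
    (cong₂ (λ a b → pos (suc h) * (pos 2 - pos (suc h)) + pos 2 * pos a + b) (∑min-surround h hs r) (eig-surround hs r))
    (lemma (pos h) (pos (∑min h hs)) (pos (length hs ℕ.+ r)) (eig hs) (pos (total hs)))
    where
    lemma : ∀ h m l e t → (1ℤ + h) * (pos 2 - (1ℤ + h)) + pos 2 * (m + l) + (e - pos 2 * t + l * l) ≡
            h * (pos 2 - h) + pos 2 * m + e - pos 2 * (h + t) + (1ℤ + l) * (1ℤ + l)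
    lemma = solve-∀

  surround-All : ∀ {h hs} r → 1 ℕ.≤ h → All (λ x → suc x ℕ.≤ h) hs → All (ℕ._≤ h) (surround hs r)
  surround-All zero    1≤h []       = []
  surround-All (suc r) 1≤h []       = 1≤h ∷ surround-All r 1≤h []
  surround-All r       1≤h (p ∷ ps) = p ∷ surround-All r 1≤h ps

  length-surround : ∀ hs r → length (surround hs r) ≡ length hs ℕ.+ r
  length-surround []       zero    = refl
  length-surround []       (suc r) = cong suc (length-surround [] r)
  length-surround (h ∷ hs) r       = cong suc (length-surround hs r)

  -- Arms below `v` mean at most `v` columns, legs below `w` at most `w` rows; with these bounds the
  -- next hook outwards fits around the columns.
  record Columns (v w n : ℕ) (k : ℤ) : Set where
    field
      heights : List ℕ
      total≡  : total heights ≡ n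
      eig≡    : eig heights ≡ pos 2 * k + pos n
      length≤ : length heights ℕ.≤ v
      all≤    : All (ℕ._≤ w) heights
  open Columns public

  columns : ∀ {v w n k} → Diagram v w n k → Columns v w n k
  columns empty = record { heights = [] ; total≡ = refl ; eig≡ = refl ; length≤ = z≤n ; all≤ = [] }
  columns {v} {w} (hook {m} {j} a b a<v b<w D) = record
    { heights = suc b ∷ surround hs r
    ; total≡  = cong suc (trans (cong (λ c → b ℕ.+ c) total-inner) (arrange b m a))
    ; eig≡    = eig-columns
    ; length≤ = subst (ℕ._≤ v) (sym (cong suc (trans (length-surround hs r) l+r≡a))) a<v
    ; all≤    = b<w ∷ All.map (λ p → ℕ.≤-trans p b<w) heights≤
    }
    where
    C : Columns a b m j
    C = columns D
    hs : List ℕ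
    hs = heights C
    r : ℕ
    -- Columns of height 1 that extend the first row to arm `a`; `length≤ C` prevents truncation.
    r = a ∸ length hs
    l+r≡a : length hs ℕ.+ r ≡ a
    l+r≡a = ℕ.m+[n∸m]≡n (length≤ C)
    total-inner : total (surround hs r) ≡ m ℕ.+ a
    total-inner = trans (total-surround hs r) (cong₂ ℕ._+_ (total≡ C) l+r≡a)
    heights≤ : All (ℕ._≤ suc b) (surround hs r)
    heights≤ = surround-All r (s≤s z≤n) (All.map s≤s (all≤ C))
    arrange : ∀ b m a → b ℕ.+ (m ℕ.+ a) ≡ a ℕ.+ b ℕ.+ m
    arrange = ℕ.solve-∀
    left : ∀ a b m j → (1ℤ + b) * (pos 2 - (1ℤ + b)) + pos 2 * (m + a) + (pos 2 * j + m - pos 2 * m + a * a) ≡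
           a * (a + 1ℤ) - b * (b + 1ℤ) + pos 2 * j + (1ℤ + (a + b + m))
    left = solve-∀
    right : ∀ x y j n → pos 2 * x - pos 2 * y + pos 2 * j + n ≡ pos 2 * (x - y + j) + n
    right = solve-∀
    eig-columns : eig (suc b ∷ surround hs r) ≡ pos 2 * (pos (tri a) - pos (tri b) + j) + pos (suc (a ℕ.+ b ℕ.+ m))
    eig-columns = begin
      c + pos 2 * pos (∑min (suc b) (surround hs r)) + eig (surround hs r)
        -- No column is taller than the first, so the minima with it add up to the total of the
        -- others.
        ≡⟨ cong₂ (λ x y → c + pos 2 * pos x + y) (trans (∑min-All heights≤) total-inner) (eig-surround hs r) ⟩
      c + pos 2 * pos (m ℕ.+ a) + (eig hs - pos 2 * pos (total hs) + pos (length hs ℕ.+ r) * pos (length hs ℕ.+ r))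
        ≡⟨ cong₂ (λ x y → c + pos 2 * pos (m ℕ.+ a) + (x - pos 2 * pos (total hs) + pos y * pos y)) (eig≡ C) l+r≡a ⟩
      c + pos 2 * pos (m ℕ.+ a) + (pos 2 * j + pos m - pos 2 * pos (total hs) + pos a * pos a)
        ≡⟨ cong (λ x → c + pos 2 * pos (m ℕ.+ a) + (pos 2 * j + pos m - pos 2 * pos x + pos a * pos a)) (total≡ C) ⟩
      c + pos 2 * pos (m ℕ.+ a) + (pos 2 * j + pos m - pos 2 * pos m + pos a * pos a)
        ≡⟨ left (pos a) (pos b) (pos m) j ⟩
      pos a * (pos a + 1ℤ) - pos b * (pos b + 1ℤ) + pos 2 * j + size
        ≡⟨ cong₂ (λ x y → x - y + pos 2 * j + size) (sym (2*tri a)) (sym (2*tri b)) ⟩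
      pos 2 * pos (tri a) - pos 2 * pos (tri b) + pos 2 * j + size
        ≡⟨ right (pos (tri a)) (pos (tri b)) j size ⟩
      pos 2 * (pos (tri a) - pos (tri b) + j) + size ∎
      where
      open ≡-Reasoning
      c size : ℤ
      c    = pos (suc b) * (pos 2 - pos (suc b))
      size = 1ℤ + (pos a + pos b + pos m)

  -- Conjugation and covered intervals.

  widen : ∀ {v v′ w w′ n k} → v ℕ.≤ v′ → w ℕ.≤ w′ → Diagram v w n k → Diagram v′ w′ n k
  widen p q empty              = empty
  widen p q (hook a b a<v b<w D) = hook a b (ℕ.≤-trans a<v p) (ℕ.≤-trans b<w q) D

  conjugate : ∀ {v w n k} → Diagram v w n k → Diagram w v n (- k)
  conjugate empty = empty
  conjugate {v} {w} (hook {m} {j} a b a<v b<w D) =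
    subst₂ (Diagram w v) (cong (λ c → suc (c ℕ.+ m)) (ℕ.+-comm b a)) (lemma (pos (tri a)) (pos (tri b)) j)
      (hook b a b<w a<v (conjugate D))
    where
    lemma : ∀ x y j → y - x + - j ≡ - (x - y + j)
    lemma = solve-∀

  attach : ∀ {v w m n k} a b → a ℕ.< v → b ℕ.< w → suc (a ℕ.+ b ℕ.+ m) ≡ n →
           Diagram a b m (k - (pos (tri a) - pos (tri b))) → Diagram v w n k
  attach {v} {w} {m} {k = k} a b a<v b<w refl D =
    subst (Diagram v w (suc (a ℕ.+ b ℕ.+ m))) (lemma (pos (tri a) - pos (tri b)) k) (hook a b a<v b<w D)
    where
    lemma : ∀ x k → x + (k - x) ≡ k
    lemma = solve-∀

  Covers : ℕ → ℕ → ℕ → Set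
  Covers w n M = ∀ k → ∣ k ∣ ℕ.≤ M → Diagram w w n k

  -- Conjugation negates content sums, and `Covers` bounds arms and legs by the same `w`.
  covers-nonNegative : ∀ {w n M} → (∀ k → k ℕ.≤ M → Diagram w w n (pos k)) → Covers w n M
  covers-nonNegative c (pos k)  k≤M = c k k≤M
  covers-nonNegative c -[1+ k ] k≤M = conjugate (c (suc k) k≤M)

  covers-mono : ∀ {v w n M N} → v ℕ.≤ w → N ℕ.≤ M → Covers v n M → Covers w n N
  covers-mono v≤w N≤M c k k≤N = widen v≤w v≤w (c k (ℕ.≤-trans k≤N N≤M))

  -- Search for diagrams of small size.

  first : ∀ {A : Set} n → (∀ a → a ℕ.< n → Maybe A) → Maybe A
  first zero    f = nothing
  first (suc n) f = f n ℕ.≤-refl <∣> first n (λ a a<n → f a (ℕ.m≤n⇒m≤1+n a<n))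

  -- A diagram with arms < a and legs < b has at most a * b cells, which prunes the search.
  search : ℕ → ∀ v w n k → Maybe (Diagram v w n k)
  search fuel       v w zero    k with k ℤ.≟ 0ℤ
  ... | yes refl = just empty
  ... | no _     = nothing
  search zero       v w (suc n) k = nothing
  search (suc fuel) v w (suc n) k =
    first v λ a a<v → first w λ b b<w → try a b a<v b<w (a ℕ.+ b ℕ.≤? n)
    where
    try : ∀ a b → a ℕ.< v → b ℕ.< w → Dec (a ℕ.+ b ℕ.≤ n) → Maybe (Diagram v w (suc n) k)
    try a b a<v b<w (no _)      = nothing
    try a b a<v b<w (yes a+b≤n) with n ∸ (a ℕ.+ b) ℕ.≤ᵇ a ℕ.* b
    ... | false = nothing
    ... | true  = Maybe.map (attach a b a<v b<w (cong suc (ℕ.m+[n∸m]≡n a+b≤n)))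
      (search fuel a b (n ∸ (a ℕ.+ b)) (k - (pos (tri a) - pos (tri b))))

  searchAll : ∀ w n M → Maybe (∀ k → k ℕ.≤ M → Diagram w w n (pos k))
  -- Arms strictly decrease inwards, so a diagram with arms below `w` has at most `w` hooks: fuel
  -- `w` suffices.
  searchAll w n zero    = Maybe.map (λ { D .zero z≤n → D }) (search w w w n 0ℤ)
  searchAll w n (suc M) = Maybe.zipWith extend (search w w w n (pos (suc M))) (searchAll w n M)
    where
    extend : Diagram w w n (pos (suc M)) → (∀ k → k ℕ.≤ M → Diagram w w n (pos k)) →
             ∀ k → k ℕ.≤ suc M → Diagram w w n (pos k)
    extend D c k k≤1+M with k ℕ.≟ suc M
    ... | yes refl = D
    ... | no k≢1+M = c k (ℕ.≤-pred (ℕ.≤∧≢⇒< k≤1+M k≢1+M))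

  -- For concrete numbers the hypothesis evaluates to the unit type, so type checking runs the
  -- search.
  covers-search : ∀ w n M → T (is-just (searchAll w n M)) → Covers w n M
  covers-search w n M t = covers-nonNegative (to-witness-T (searchAll w n M) t)

  -- The names give the size, then the bound on arms and legs. A smaller bound admits outer hooks
  -- with shorter leg and longer arm; a larger one can widen the interval, as the two entries of
  -- size 17 show.
  covers-13-8 : Covers 8 13 15
  covers-13-8 = covers-search 8 13 15 _

  covers-17-8 : Covers 8 17 29
  covers-17-8 = covers-search 8 17 29 _

  covers-17-9 : Covers 9 17 32
  covers-17-9 = covers-search 9 17 32 _

  covers-19-9 : Covers 9 19 37
  covers-19-9 = covers-search 9 19 37 _

  covers-22-9 : Covers 9 22 49
  covers-22-9 = covers-search 9 22 49 _

  covers-23-12 : Covers 12 23 80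
  covers-23-12 = covers-search 12 23 80 _

  -- Covering longer intervals by outer hooks.

  ∣∣≤ : ∀ {M} k → - pos M ≤ k → k ≤ pos M → ∣ k ∣ ℕ.≤ M
  ∣∣≤ (pos k)  _ (+≤+ k≤M) = k≤M
  ∣∣≤ {suc M} -[1+ k ] (-≤- k≤M) _ = s≤s k≤M

  -- Leaves an equation between differences, which the ring solver proves.
  combine : ∀ {a b x y : ℤ} → a ≤ b → x - y ≡ a - b → x ≤ y
  combine {a} {b} {x} {y} a≤b eq = ℤ.i-j≤0⇒i≤j (subst (_≤ 0ℤ) (sym eq) (ℤ.i≤j⇒i-j≤0 a≤b))

  attach-near : ∀ {u v w s M n k} a b → u ℕ.≤ a → u ℕ.≤ b → a ℕ.< v → b ℕ.< w → suc (a ℕ.+ b ℕ.+ s) ≡ n → Covers u s M →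
                pos (tri a) - pos (tri b) - pos M ≤ k → k ≤ pos (tri a) - pos (tri b) + pos M → Diagram v w n k
  attach-near {M = M} {k = k} a b u≤a u≤b a<v b<w eq c lo hi = attach a b a<v b<w eq
    (widen u≤a u≤b (c _ (∣∣≤ (k - d) (combine lo (lemma₁ d (pos M) k)) (combine hi (lemma₂ d (pos M) k)))))
    where
    d : ℤ
    d = pos (tri a) - pos (tri b)
    lemma₁ : ∀ d m k → - m - (k - d) ≡ d - m - k
    lemma₁ = solve-∀
    lemma₂ : ∀ d m k → k - d - m ≡ k - (d + m)
    lemma₂ = solve-∀

  -- Sliding one cell from the leg to the arm of the outer hook raises the content sum by
  -- the hook length, so the intervals reached by consecutive hooks leave no gap.
  slide : ∀ {u v w s M} → Covers u s M → ∀ t a b {n k} → u ℕ.≤ a → u ℕ.≤ b → a ℕ.+ t ℕ.< v → b ℕ.+ t ℕ.< w →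
          suc (a ℕ.+ b ℕ.+ t ℕ.+ s) ≡ n → a ℕ.+ b ℕ.+ t ℕ.≤ 2 ℕ.* M →
          pos (tri a) - pos (tri (b ℕ.+ t)) - pos M ≤ k → k ≤ pos (tri (a ℕ.+ t)) - pos (tri b) + pos M → Diagram v w n k
  slide {s = s} {M = M} c zero a b {k = k} u≤a u≤b a<v b<w eq gap lo hi
    rewrite ℕ.+-identityʳ a | ℕ.+-identityʳ b | ℕ.+-identityʳ (a ℕ.+ b) = attach-near a b u≤a u≤b a<v b<w eq c lo hi
  slide {v = v} {s = s} {M = M} c (suc t) a b {n} {k} u≤a u≤b a<v b<w eq gap lo hi
    with k ℤ.≤? pos (tri a) - pos (tri (b ℕ.+ suc t)) + pos M
  ... | yes k≤ = attach-near a (b ℕ.+ suc t) u≤a (ℕ.≤-trans u≤b (ℕ.m≤m+n b (suc t))) (ℕ.≤-<-trans (ℕ.m≤m+n a (suc t)) a<v) b<w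
                   (trans (cong (λ x → suc (x ℕ.+ s)) (sym (ℕ.+-assoc a b (suc t)))) eq) c lo k≤
  ... | no k≰ = slide c t (suc a) b (ℕ.m≤n⇒m≤1+n u≤a) u≤b
                  (subst (ℕ._< v) (ℕ.+-suc a t) a<v) (ℕ.<-trans (ℕ.+-monoʳ-< b (ℕ.n<1+n t)) b<w)
                  (trans (cong (λ x → suc (x ℕ.+ s)) shift) eq) (subst (ℕ._≤ 2 ℕ.* M) (sym shift) gap)
                  next (subst (λ x → k ≤ pos (tri x) - pos (tri b) + pos M) (ℕ.+-suc a t) hi)
    where
    shift : suc a ℕ.+ b ℕ.+ t ≡ a ℕ.+ b ℕ.+ suc t
    shift = sym (ℕ.+-suc (a ℕ.+ b) t)
    lemma : ∀ a b t x y M → 1ℤ + a + x - y - M - (1ℤ + (x - (1ℤ + (b + t) + y) + M)) ≡ (a + b + (1ℤ + t)) - pos 2 * M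
    lemma = solve-∀
    next : pos (tri (suc a)) - pos (tri (b ℕ.+ t)) - pos M ≤ k
    next = ℤ.≤-trans
      (combine (+≤+ gap) (trans (lemma (pos a) (pos b) (pos t) (pos (tri a)) (pos (tri (b ℕ.+ t))) (pos M))
                                (cong (λ x → pos (a ℕ.+ b ℕ.+ suc t) - x) (sym (ℤ.pos-* 2 M)))))
      (subst (λ x → 1ℤ + (pos (tri a) - pos (tri x) + pos M) ≤ k) (ℕ.+-suc b t) (ℤ.i<j⇒suc[i]≤j (ℤ.≰⇒> k≰)))

  tri-mono : ∀ {a b} → a ℕ.≤ b → tri a ℕ.≤ tri b
  tri-mono z≤n       = z≤n
  tri-mono (s≤s a≤b) = ℕ.+-mono-≤ (s≤s a≤b) (tri-mono a≤b)

  -- The cells of the outer hook beyond its corner, an arm `u` and a leg `u`. The first component of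
  -- `Extends` rules out truncation.
  slack : ℕ → ℕ → ℕ → ℕ
  slack u s n = n ∸ suc (u ℕ.+ u ℕ.+ s)

  -- The arithmetic conditions under which the outer hooks (u + i , u + t - i), with
  -- t = slack u s n, around the diagrams of size s cover [-N , N].
  Extends : ℕ → ℕ → ℕ → ℕ → ℕ → ℕ → Set
  Extends u s M w n N = suc (u ℕ.+ u ℕ.+ slack u s n ℕ.+ s) ≡ n × u ℕ.+ slack u s n ℕ.< w ×
    u ℕ.+ u ℕ.+ slack u s n ℕ.≤ 2 ℕ.* M × N ℕ.+ tri u ℕ.≤ tri (u ℕ.+ slack u s n) ℕ.+ M

  extends? : ∀ u s M w n N → Dec (Extends u s M w n N)
  extends? u s M w n N = (_ ℕ.≟ _) ×-dec (_ ℕ.<? _) ×-dec (_ ℕ.≤? _) ×-dec (_ ℕ.≤? _)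

  extend : ∀ {u s M w n N} → Covers u s M → Extends u s M w n N → Covers w n N
  extend {u} {s} {M} {w} {n} {N} c (size , width , gap , reach) = covers-nonNegative λ k k≤N →
    slide c t u u ℕ.≤-refl ℕ.≤-refl width width size gap
      -- The slide starts from a hook with leg at least its arm, so its interval begins at or below
      -- 0.
      (combine (ℤ.+-mono-≤ (+≤+ (tri-mono (ℕ.m≤m+n u t))) (+≤+ (z≤n {k ℕ.+ M})))
               (lemma₁ (pos (tri u)) (pos (tri (u ℕ.+ t))) (pos M) (pos k)))
      (combine (+≤+ (ℕ.≤-trans (ℕ.+-monoˡ-≤ (tri u) k≤N) reach))
               (lemma₂ (pos (tri u)) (pos (tri (u ℕ.+ t))) (pos M) (pos k)))
    where
    t : ℕ
    t = slack u s n
    lemma₁ : ∀ x y M k → x - y - M - k ≡ x + 0ℤ - (y + (k + M))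
    lemma₁ = solve-∀
    lemma₂ : ∀ x y M k → k - (y - x + M) ≡ k + x - (y + M)
    lemma₂ = solve-∀

  on-range : ∀ {Q : ℕ → Set} (Q? : ∀ n → Dec (Q n)) lo len → True (ℕ.allUpTo? (λ i → Q? (lo ℕ.+ i)) len) →
             ∀ {n} → lo ℕ.≤ n → n ℕ.< lo ℕ.+ len → Q n
  on-range {Q} Q? lo len ok {n} lo≤n n<hi = subst Q n≡
    (toWitness ok (ℕ.+-cancelˡ-< lo (n ∸ lo) len (subst (ℕ._< lo ℕ.+ len) (sym n≡) n<hi)))
    where
    n≡ : lo ℕ.+ (n ∸ lo) ≡ n
    n≡ = ℕ.m+[n∸m]≡n lo≤n

  extend-range : ∀ {u s M} → Covers u s M → (N : ℕ → ℕ) → ∀ lo len →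
                 True (ℕ.allUpTo? (λ i → extends? u s M (lo ℕ.+ i) (lo ℕ.+ i) (N (lo ℕ.+ i))) len) →
                 ∀ {n} → lo ℕ.≤ n → n ℕ.< lo ℕ.+ len → Covers n n (N n)
  extend-range {u} {s} {M} c N lo len ok lo≤n n<hi = extend c (on-range (λ n → extends? u s M n n (N n)) lo len ok lo≤n n<hi)

  -- The same for one more hook, of leg b, that lengthens a covered interval [-X , X] to [-N , N].
  Patches : ℕ → ℕ → ℕ → ℕ → ℕ → ℕ → ℕ → Set
  Patches u s M b n X N = suc (n ∸ suc (b ℕ.+ s) ℕ.+ b ℕ.+ s) ≡ n × u ℕ.≤ n ∸ suc (b ℕ.+ s) × u ℕ.≤ b ×
    n ∸ suc (b ℕ.+ s) ℕ.< n × b ℕ.< n ×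
    tri (n ∸ suc (b ℕ.+ s)) ℕ.≤ suc X ℕ.+ M ℕ.+ tri b × N ℕ.+ tri b ℕ.≤ tri (n ∸ suc (b ℕ.+ s)) ℕ.+ M

  patches? : ∀ u s M b n X N → Dec (Patches u s M b n X N)
  patches? u s M b n X N = (_ ℕ.≟ _) ×-dec (_ ℕ.≤? _) ×-dec (_ ℕ.≤? _) ×-dec (_ ℕ.<? _) ×-dec (_ ℕ.<? _) ×-dec
                           (_ ℕ.≤? _) ×-dec (_ ℕ.≤? _)

  -- `low` makes the interval of the extra hook begin at or before `suc X`, so nothing is skipped;
  -- `high` makes it reach `N`.
  patch : ∀ {u s M b n X N} → Covers u s M → Covers n n X → Patches u s M b n X N → Covers n n N
  patch {u} {s} {M} {b} {n} {X} {N} c cX (size , u≤a , u≤b , a<n , b<n , low , high) = covers-nonNegative cover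
    where
    a : ℕ
    a = n ∸ suc (b ℕ.+ s)
    lemma₂ : ∀ x y M k → k - (x - y + M) ≡ k + y - (x + M)
    lemma₂ = solve-∀
    cover : ∀ k → k ℕ.≤ N → Diagram n n n (pos k)
    cover k k≤N with k ℕ.≤? X
    ... | yes k≤X = cX (pos k) k≤X
    ... | no k≰X = attach-near a b u≤a u≤b a<n b<n size c
      (combine (+≤+ (ℕ.≤-trans low (ℕ.+-monoˡ-≤ (tri b) (ℕ.+-monoˡ-≤ M (ℕ.≰⇒> k≰X)))))
               (lemma₀ (pos (tri a)) (pos (tri b)) (pos M) (pos k)))
      (combine (+≤+ (ℕ.≤-trans (ℕ.+-monoˡ-≤ (tri b) k≤N) high)) (lemma₂ (pos (tri a)) (pos (tri b)) (pos M) (pos k)))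
      where
      lemma₀ : ∀ x y M k → x - y - M - k ≡ x - (k + M + y)
      lemma₀ = solve-∀

  patch-range : ∀ {u s M u′ s′ M′} → Covers u s M → Covers u′ s′ M′ → ∀ b (X N : ℕ → ℕ) lo len →
                True (ℕ.allUpTo? (λ i → extends? u s M (lo ℕ.+ i) (lo ℕ.+ i) (X (lo ℕ.+ i)) ×-dec
                                        patches? u′ s′ M′ b (lo ℕ.+ i) (X (lo ℕ.+ i)) (N (lo ℕ.+ i))) len) →
                ∀ {n} → lo ℕ.≤ n → n ℕ.< lo ℕ.+ len → Covers n n (N n)
  patch-range {u} {s} {M} {u′} {s′} {M′} c c′ b X N lo len ok {n} lo≤n n<hi
    with on-range (λ n → extends? u s M n n (X n) ×-dec patches? u′ s′ M′ b n (X n) (N n)) lo len ok lo≤n n<hi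
  ... | e , p = patch {n = n} {X = X n} {N = N n} c′ (extend c e) p

  -- The sizes below 416.

  bound : ℕ → ℕ
  bound n = tri ((2 ℕ.* n ℕ.+ 1) / 3 ∸ 1)

  -- Longer hooks need a larger `M` inside them. This interval and the next come from sliding hooks
  -- around `covers-22-9`; both are the longest its `Extends` condition allows.
  covers-46-15 : Covers 15 46 109
  covers-46-15 = extend covers-22-9 (toWitness {a? = extends? 9 22 49 15 46 109} _)

  covers-51-20 : Covers 20 51 194
  covers-51-20 = extend covers-22-9 (toWitness {a? = extends? 9 22 49 20 51 194} _)

  -- The functions of n passed to patch-range are the ends of the intervals that its first argument
  -- covers.
  covers-small : ∀ {n} → 76 ℕ.≤ n → n ℕ.< 416 → Covers n n (bound n)
  -- At 77, 83, 95, 122 and 185 the condition `n - s - 1 ≤ 2 * M` fails for the inner diagrams slid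
  -- around just before. For 76 to 79 and 83 to 85 the slide falls short of `bound n` and is
  -- patched.
  covers-small {n} 76≤n n<416 with n ℕ.<? 77
  -- The slide ends at 1268, while `bound 76` is 1275. The patch, with arm 51 and leg 11, reaches
  -- `tri 51 - tri 11 + 15 = 1275`, exactly the bound.
  ... | yes n<77 = patch-range covers-17-8 covers-13-8 11 (λ n → tri (n ∸ 26) ∸ 7) bound 76 1 _ 76≤n n<77
  ... | no n≮77 with n ℕ.<? 80
  ... | yes n<80 = patch-range covers-17-9 covers-17-8 8 (λ n → tri (n ∸ 27) ∸ 13) bound 77 3 _ (ℕ.≮⇒≥ n≮77) n<80
  ... | no n≮80 with n ℕ.<? 83
  ... | yes n<83 = extend-range covers-17-9 bound 80 3 _ (ℕ.≮⇒≥ n≮80) n<83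
  ... | no n≮83 with n ℕ.<? 86
  ... | yes n<86 = patch-range covers-19-9 covers-17-9 10 (λ n → tri (n ∸ 29) ∸ 8) bound 83 3 _ (ℕ.≮⇒≥ n≮83) n<86
  ... | no n≮86 with n ℕ.<? 95
  ... | yes n<95 = extend-range covers-19-9 bound 86 9 _ (ℕ.≮⇒≥ n≮86) n<95
  ... | no n≮95 with n ℕ.<? 122
  ... | yes n<122 = extend-range covers-22-9 bound 95 27 _ (ℕ.≮⇒≥ n≮95) n<122
  ... | no n≮122 with n ℕ.<? 185
  ... | yes n<185 = extend-range covers-23-12 bound 122 63 _ (ℕ.≮⇒≥ n≮122) n<185
  ... | no n≮185 with n ℕ.<? 265
  ... | yes n<265 = extend-range covers-46-15 bound 185 80 _ (ℕ.≮⇒≥ n≮185) n<265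
  ... | no n≮265 = extend-range covers-51-20 bound 265 151 _ (ℕ.≮⇒≥ n≮265) n<416

  -- Inner intervals for sizes `416 ≤ n` with `n / 8` still below 76. Size 52 is the first at which
  -- hooks around `covers-22-9` reach `4 n + 4`, and `416 = 8 * 52`.
  covers-linear-small : ∀ {n} → 52 ℕ.≤ n → n ℕ.< 76 → Covers n n (4 ℕ.* n ℕ.+ 4)
  covers-linear-small = extend-range covers-22-9 (λ n → 4 ℕ.* n ℕ.+ 4) 52 24 _

  -- Arithmetic for large sizes.

  tri-+ : ∀ a b → tri (a ℕ.+ b) ≡ tri a ℕ.+ tri b ℕ.+ a ℕ.* b
  tri-+ zero    b = sym (ℕ.+-identityʳ (tri b))
  tri-+ (suc a) b = trans (cong (λ x → suc (a ℕ.+ b) ℕ.+ x) (tri-+ a b)) (lemma a b (tri a) (tri b))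
    where
    lemma : ∀ a b x y → suc (a ℕ.+ b) ℕ.+ (x ℕ.+ y ℕ.+ a ℕ.* b) ≡ suc a ℕ.+ x ℕ.+ y ℕ.+ suc a ℕ.* b
    lemma = ℕ.solve-∀

  tri-double : ∀ a → 2 ℕ.* tri a ≡ a ℕ.* suc a
  tri-double zero    = refl
  tri-double (suc a) = trans (ℕ.*-distribˡ-+ 2 (suc a) (tri a)) (trans (cong (λ x → 2 ℕ.* suc a ℕ.+ x) (tri-double a)) (lemma a))
    where
    lemma : ∀ a → 2 ℕ.* suc a ℕ.+ a ℕ.* suc a ≡ suc a ℕ.* suc (suc a)
    lemma = ℕ.solve-∀

  -- Linear arithmetic: a goal x ≤ y is reduced by adding hypotheses a ≤ b crosswise until the two
  -- sides differ by an explicit natural number.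
  eliminate : ∀ {a b} x y → a ℕ.≤ b → x ℕ.+ b ℕ.≤ y ℕ.+ a → x ℕ.≤ y
  eliminate {a} {b} x y a≤b p = ℕ.+-cancelʳ-≤ b x y (ℕ.≤-trans p (ℕ.+-monoʳ-≤ y a≤b))

  by-difference : ∀ {x y} d → x ℕ.+ d ≡ y → x ℕ.≤ y
  by-difference {x} d refl = ℕ.m≤m+n x d

  -- Replaces the floor by linear inequalities: `u + 1` is the quotient of `2 n + 1` by 3, with
  -- remainder at most 2.
  record BoundArgument (n : ℕ) : Set where
    field
      u      : ℕ
      bound≡ : bound n ≡ tri u
      lower  : 3 ℕ.* u ℕ.+ 3 ℕ.≤ 2 ℕ.* n ℕ.+ 1
      upper  : 2 ℕ.* n ℕ.+ 1 ℕ.≤ 3 ℕ.* u ℕ.+ 5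

  boundArgument : ∀ n → 1 ℕ.≤ n → BoundArgument n
  boundArgument n 1≤n = go ((2 ℕ.* n ℕ.+ 1) / 3) refl
    where
    r : ℕ
    r = (2 ℕ.* n ℕ.+ 1) % 3
    r≤2 : r ℕ.≤ 2
    r≤2 = ℕ.≤-pred (m%n<n (2 ℕ.* n ℕ.+ 1) 3)
    lemma₁ : ∀ r u → 3 ℕ.* u ℕ.+ 3 ℕ.+ r ≡ r ℕ.+ suc u ℕ.* 3
    lemma₁ = ℕ.solve-∀
    lemma₂ : ∀ u → 2 ℕ.+ suc u ℕ.* 3 ≡ 3 ℕ.* u ℕ.+ 5
    lemma₂ = ℕ.solve-∀
    go : ∀ m → (2 ℕ.* n ℕ.+ 1) / 3 ≡ m → BoundArgument n
    go m eq with m≡m%n+[m/n]*n (2 ℕ.* n ℕ.+ 1) 3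
    ... | n≡ rewrite eq with m
    -- A zero quotient would give `3 ≤ 2 * n + 1 ≤ 2`.
    ...   | zero  = contradiction
      (ℕ.≤-trans (ℕ.+-monoˡ-≤ 1 (ℕ.*-monoʳ-≤ 2 1≤n)) (subst (ℕ._≤ 2) (sym (trans n≡ (ℕ.+-identityʳ r))) r≤2))
      λ { (s≤s (s≤s ())) }
    ...   | suc u = record
      { u      = u
      ; bound≡ = cong (λ m → tri (m ∸ 1)) eq
      ; lower  = by-difference r (trans (lemma₁ r u) (sym n≡))
      ; upper  = subst₂ ℕ._≤_ (sym n≡) (lemma₂ u) (ℕ.+-monoˡ-≤ (suc u ℕ.* 3) r≤2)
      }

open Eigenvectors using (eigenvalue)
open Diagrams
open import Data.Nat using (ℕ; _≤_; _+_; _*_; _/_)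
open import Data.Nat.Combinatorics using (_C_)
open import Data.Integer using (ℤ; +_; -_) renaming (_≤_ to _≤ℤ_)
open import Data.Nat using (zero; suc; _<_; _∸_; z≤n; s≤s)
open import Data.Nat.Combinatorics using (nCk+nC[k+1]≡[n+1]C[k+1]; nC1≡n)
open import Data.Nat.DivMod using (_%_; m≡m%n+[m/n]*n; m%n<n)
open import Data.Nat.Induction using (<-rec)
import Data.Integer as ℤ
import Data.Nat as ℕ
import Data.Nat.Tactic.RingSolver as ℕ

-- Here s is about n / 8 and u about 2 n / 3, where n = 3 s + 1 + t.
reach-large : ∀ s t u → 2 ≤ s → 8 * s ≤ suc (3 * s + t) →
              3 * u + 3 ≤ 2 * suc (3 * s + t) + 1 → 2 * suc (3 * s + t) + 1 ≤ 3 * u + 5 →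
              tri u + tri s ≤ tri (s + t)
reach-large s t u 2≤s 8s≤n lower upper = begin
  -- Writing `s + t = u + e`, the surplus of `tri (s + t)` over `tri u` is `tri e + u * e`; already
  -- `u * e` outweighs `tri s`, as `s ≤ 2 * e` and `s < u`.
  tri u + tri s          ≤⟨ ℕ.+-monoʳ-≤ (tri u) tri-s≤ ⟩
  tri u + u * e          ≤⟨ by-difference (tri e) (lemma₀ (tri u) (u * e) (tri e)) ⟩
  tri u + tri e + u * e  ≡⟨ tri-+ u e ⟨
  tri (u + e)            ≡⟨ cong tri u+e≡ ⟩
  tri (s + t) ∎
  where
  open ℕ.≤-Reasoning
  lemma₀ : ∀ a b c → a + b + c ≡ a + c + b
  lemma₀ = ℕ.solve-∀
  u≤ : u ≤ s + t
  u≤ = ℕ.*-cancelˡ-≤ 3 (eliminate (3 * u) (3 * (s + t)) lower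
         (eliminate (3 * u + (2 * suc (3 * s + t) + 1)) (3 * (s + t) + (3 * u + 3)) 8s≤n
         (eliminate _ _ 2≤s (by-difference (s + 1) (lemma s t u)))))
    where
    lemma : ∀ s t u → 3 * u + (2 * suc (3 * s + t) + 1) + suc (3 * s + t) + s + (s + 1) ≡
                      3 * (s + t) + (3 * u + 3) + 8 * s + 2
    lemma = ℕ.solve-∀
  e : ℕ
  -- About `n / 12`, since `s + t` is about `3 n / 4`; hence `2 * e`, about `n / 6`, exceeds `s`,
  -- about `n / 8`.
  e = s + t ∸ u
  u+e≡ : u + e ≡ s + t
  u+e≡ = ℕ.m+[n∸m]≡n u≤
  s≤2e : s ≤ 2 * e
  s≤2e = ℕ.*-cancelˡ-≤ 3 (eliminate (3 * s) (3 * (2 * e)) (ℕ.≤-reflexive (cong (6 *_) (sym u+e≡)))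
         (eliminate _ _ (ℕ.*-monoʳ-≤ 2 lower) (eliminate _ _ (ℕ.*-monoʳ-≤ 2 8s≤n)
         (eliminate _ _ 2≤s (ℕ.≤-reflexive (lemma s t u e))))))
    where
    lemma : ∀ s t u e → 3 * s + 6 * (u + e) + 2 * (2 * suc (3 * s + t) + 1) + 2 * suc (3 * s + t) + s ≡
                        3 * (2 * e) + 6 * (s + t) + 2 * (3 * u + 3) + 2 * (8 * s) + 2
    lemma = ℕ.solve-∀
  s<u : suc s ≤ u
  s<u = ℕ.*-cancelˡ-≤ 3 (eliminate (3 * suc s) (3 * u) upper (eliminate _ _ (ℕ.*-monoʳ-≤ 2 8s≤n)
        (eliminate _ _ (ℕ.*-monoʳ-≤ 13 2≤s) (by-difference 19 (lemma s t u)))))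
    where
    lemma : ∀ s t u → 3 * suc s + (3 * u + 5) + 2 * suc (3 * s + t) + 13 * s + 19 ≡
                      3 * u + (2 * suc (3 * s + t) + 1) + 2 * (8 * s) + 13 * 2
    lemma = ℕ.solve-∀
  tri-s≤ : tri s ≤ u * e
  tri-s≤ = ℕ.*-cancelˡ-≤ 2 (begin
    2 * tri s      ≡⟨ tri-double s ⟩
    s * suc s      ≤⟨ ℕ.*-mono-≤ s≤2e s<u ⟩
    2 * e * u      ≡⟨ lemma₁ e u ⟩
    2 * (u * e) ∎)
    where
    lemma₁ : ∀ e u → 2 * e * u ≡ 2 * (u * e)
    lemma₁ = ℕ.solve-∀

-- Quadratic against linear growth: `50 ≤ u` turns `u * suc u`, which is `2 * tri u`, into a
-- multiple of `suc u` that suffices.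
linear-bound : ∀ n → 76 ≤ n → 4 * n + 4 ≤ bound n
linear-bound n 76≤n = subst (4 * n + 4 ≤_) (sym (bound≡ τ)) (ℕ.*-cancelˡ-≤ 6 (begin
  6 * (4 * n + 4)        ≤⟨ eliminate _ _ (ℕ.*-monoʳ-≤ 50 (upper τ))
                            (eliminate _ _ (ℕ.*-monoʳ-≤ 76 76≤n) (by-difference 5702 (lemma₁ n (u τ)))) ⟩
  3 * (50 * suc (u τ))   ≤⟨ ℕ.*-monoʳ-≤ 3 (ℕ.*-monoˡ-≤ (suc (u τ)) 50≤u) ⟩
  3 * (u τ * suc (u τ))  ≡⟨ cong (3 *_) (tri-double (u τ)) ⟨
  3 * (2 * tri (u τ))    ≡⟨ ℕ.*-assoc 3 2 (tri (u τ)) ⟨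
  6 * tri (u τ) ∎))
  where
  open ℕ.≤-Reasoning
  open BoundArgument
  τ : BoundArgument n
  τ = boundArgument n (ℕ.≤-trans (s≤s z≤n) 76≤n)
  lemma₁ : ∀ n u → 6 * (4 * n + 4) + 50 * (3 * u + 5) + 76 * n + 5702 ≡ 3 * (50 * suc u) + 50 * (2 * n + 1) + 76 * 76
  lemma₁ = ℕ.solve-∀
  50≤u : 50 ≤ u τ
  -- From `153 ≤ 2 n + 1 ≤ 3 u + 5` follows `148 ≤ 3 u`, which exceeds `3 * 49`.
  50≤u = ℕ.*-cancelˡ-< 3 49 (u τ) (eliminate _ _ (upper τ) (eliminate _ _ (ℕ.*-monoʳ-≤ 2 76≤n) (ℕ.≤-reflexive (lemma₂ n (u τ)))))
    where
    lemma₂ : ∀ n u → suc (3 * 49) + (3 * u + 5) + 2 * n ≡ 3 * u + (2 * n + 1) + 2 * 76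
    lemma₂ = ℕ.solve-∀

-- Inner arms and legs are below `s`, so outer hooks may have arm and leg from `s` on. `n ≤ 8 s + 7`
-- keeps the slide free of gaps, and `8 s ≤ n` leaves an arm long enough for `bound n`.
covers-large : ∀ {n} s → 52 ≤ s → 8 * s ≤ n → n ≤ 8 * s + 7 → Covers s s (4 * s + 4) → Covers n n (bound n)
covers-large {n} s 52≤s 8s≤n n≤8s+7 c = subst (Covers n n) (sym (bound≡ τ)) (extend c
  ( trans (size s t) n≡
  , subst (s + t <_) n≡ (s≤s (ℕ.+-monoˡ-≤ t (ℕ.m≤n*m s 3)))
  , eliminate (s + s + t) (2 * (4 * s + 4)) (subst (_≤ 8 * s + 7) (sym n≡) n≤8s+7) (by-difference (s + 2) (gap s t))
  , ℕ.≤-trans (reach-large s t (u τ) 2≤s (subst (8 * s ≤_) (sym n≡) 8s≤n)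
                (subst (λ m → 3 * u τ + 3 ≤ 2 * m + 1) (sym n≡) (lower τ))
                (subst (λ m → 2 * m + 1 ≤ 3 * u τ + 5) (sym n≡) (upper τ)))
              (ℕ.m≤m+n _ _)))
  where
  open BoundArgument
  2≤s : 2 ≤ s
  2≤s = ℕ.≤-trans (s≤s (s≤s z≤n)) 52≤s
  t : ℕ
  t = slack s s n
  fits : suc (s + s + s) ≤ n
  fits = ℕ.≤-trans (eliminate _ _ 2≤s (by-difference (4 * s + 1) (lemma s))) 8s≤n
    where
    lemma : ∀ s → suc (s + s + s) + s + (4 * s + 1) ≡ 8 * s + 2
    lemma = ℕ.solve-∀
  n≡ : suc (3 * s + t) ≡ n
  n≡ = trans (cong (λ x → suc (x + t)) (lemma s)) (ℕ.m+[n∸m]≡n fits)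
    where
    lemma : ∀ s → 3 * s ≡ s + s + s
    lemma = ℕ.solve-∀
  τ : BoundArgument n
  τ = boundArgument n (ℕ.≤-trans (s≤s z≤n) fits)
  size : ∀ s t → suc (s + s + t + s) ≡ suc (3 * s + t)
  size = ℕ.solve-∀
  gap : ∀ s t → s + s + t + (8 * s + 7) + (s + 2) ≡ 2 * (4 * s + 4) + suc (3 * s + t)
  gap = ℕ.solve-∀

-- Strong induction through the inner size `n / 8`, which is at least 52 once `416 ≤ n`. From 76 on
-- the induction hypothesis serves, weakened by `linear-bound`; below that, `covers-linear-small`.
covers-bound : ∀ n → 76 ≤ n → Covers n n (bound n)
covers-bound = <-rec (λ n → 76 ≤ n → Covers n n (bound n)) step
  where
  step : ∀ n → (∀ {m} → m < n → 76 ≤ m → Covers m m (bound m)) → 76 ≤ n → Covers n n (bound n)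
  step n rec 76≤n with n ℕ.<? 416
  ... | yes n<416 = covers-small 76≤n n<416
  ... | no n≮416 = covers-large s 52≤s 8s≤n n≤8s+7 inner
    where
    s : ℕ
    s = n / 8
    n≡ : n ≡ n % 8 + s * 8
    n≡ = m≡m%n+[m/n]*n n 8
    8s≤n : 8 * s ≤ n
    8s≤n = subst₂ _≤_ (ℕ.*-comm s 8) (sym n≡) (ℕ.m≤n+m (s * 8) (n % 8))
    n≤8s+7 : n ≤ 8 * s + 7
    n≤8s+7 = subst₂ _≤_ (sym n≡) (trans (ℕ.+-comm 7 (s * 8)) (cong (_+ 7) (ℕ.*-comm s 8)))
                    (ℕ.+-monoˡ-≤ (s * 8) (ℕ.≤-pred (m%n<n n 8)))
    52≤s : 52 ≤ s
    52≤s = ℕ.≤-pred (ℕ.*-cancelˡ-< 8 52 (suc s) (ℕ.≤-<-trans (ℕ.≮⇒≥ n≮416)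
             (ℕ.≤-<-trans n≤8s+7 (subst (8 * s + 7 <_) (lemma s) (ℕ.n<1+n _)))))
      where
      lemma : ∀ s → suc (8 * s + 7) ≡ 8 * suc s
      lemma = ℕ.solve-∀
    inner : Covers s s (4 * s + 4)
    inner with s ℕ.<? 76
    ... | yes s<76 = covers-linear-small 52≤s s<76
    ... | no s≮76 = covers-mono ℕ.≤-refl (linear-bound s 76≤s) (rec s<n 76≤s)
      where
      76≤s : 76 ≤ s
      76≤s = ℕ.≮⇒≥ s≮76
      s<n : s < n
      s<n = ℕ.<-≤-trans (ℕ.m<m*n s 8 {{ℕ.>-nonZero (ℕ.≤-trans (s≤s z≤n) 76≤s)}} (s≤s (s≤s z≤n)))
                         (subst (_≤ n) (ℕ.*-comm 8 s) 8s≤n)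

-- Binomial coefficients and the conclusion.

C2≡tri : ∀ m → m C 2 ≡ tri (m ∸ 1)
C2≡tri zero          = refl
C2≡tri (suc zero)    = refl
C2≡tri (suc (suc m)) = trans (sym (nCk+nC[k+1]≡[n+1]C[k+1] (suc m) 1)) (cong₂ _+_ (nC1≡n (suc m)) (C2≡tri (suc m)))

theorem1p3 : (n : ℕ) → 76 ≤ n → (k : ℤ)
    → - (+ (((2 * n + 1) / 3) C 2)) ≤ℤ k → k ≤ℤ + (((2 * n + 1) / 3) C 2)
    → IsTranspositionGraphEigenvalue n (ℤ→ℚ k)
theorem1p3 n 76≤n k lo hi = subst (λ m → IsTranspositionGraphEigenvalue m (ℤ→ℚ k)) (total≡ γ)
  (eigenvalue (heights γ) k (trans (cong (λ m → (+ 2) ℤ.* k ℤ.+ + m) (total≡ γ)) (sym (eig≡ γ))))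
  where
  γ : Columns n n n k
  γ = columns (covers-bound n 76≤n k (subst (λ m → ℤ.∣ k ∣ ≤ m) (C2≡tri ((2 * n + 1) / 3)) (∣∣≤ k lo hi)))
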